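{- Fix integers $n\ge 1$ and $q\geq 1$. Suppose $\ell\ge n$ is the smallest integer such that $\tilde{H}_q(\mathcal{VR}(\mathcal{F}_n^{[\ell]};2(n-1)))$ is nontrivial. Then $$\operatorname{rank}\tilde{H}_q\big(\mathcal{VR}(\mathcal{F}_n^{[\ell+1]};2(n-1))\big)\geq \ell\cdot\operatorname{rank}\tilde{H}_q\big(\mathcal{VR}(\mathcal{F}_n^{[\ell]};2(n-1))\big).$$
   Context: $\mathcal{F}_n^{[m]}$ is the set of $n$-element subsets of $[m]=\{1,\dots,m\}$ with metric $d(A,B)=|A\triangle B|$. $\mathcal{VR}(X;r)$ is the simplicial complex on $X$ whose simplices are nonempty finite sets of pairwise distance $\le r$. Note $\mathcal{VR}(\mathcal{F}_n^{[2n+k]};2(n-1))$ is the independence complex of the Kneser graph $\mathrm{KG}(n,k)$. $\tilde H_q$ denotes reduced simplicial homology with real coefficients, and rank means dimension.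
   Formalization: The reduced homology is taken with rational instead of real coefficients; the boundary matrices are integral, so the ranks are the same over both fields. -}

module Defs where

open import Data.Bool using (Bool; true; false; _∧_; _xor_; if_then_else_)
open import Data.Nat using (ℕ; zero; suc; _+_; _*_; _∸_; _≤ᵇ_; _<ᵇ_; _≡ᵇ_)
open import Data.Nat.Properties using ()
open import Data.Fin using (Fin; toℕ) renaming (_≟_ to _≟ᶠ_)
open import Data.Fin.Subset using (Subset; ∣_∣)
open import Data.List using (List; []; _∷_; [_]; map; _++_; concatMap; allFin; filterᵇ; length; lookup)
open import Data.Vec using (Vec; removeAt; toList) renaming ([] to []ᵥ; _∷_ to _∷ᵥ_)
open import Data.Vec.Properties using (≡-dec)
open import Data.Rational using (ℚ; 0ℚ; 1ℚ; -_) renaming (_+_ to _+ℚ_; _*_ to _*ℚ_)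
open import Data.Product using (Σ; ∃; _×_; _,_)
open import Relation.Binary.PropositionalEquality using (_≡_)
open import Relation.Nullary.Decidable using (⌊_⌋)

subsets : (m : ℕ) → List (Subset m)
subsets zero    = [ []ᵥ ]
subsets (suc m) = map (false ∷ᵥ_) (subsets m) ++ map (true ∷ᵥ_) (subsets m)

symDist : {m : ℕ} → Subset m → Subset m → ℕ
symDist []ᵥ       []ᵥ       = 0
symDist (x ∷ᵥ xs) (y ∷ᵥ ys) = (if x xor y then 1 else 0) + symDist xs ys

Fpts : (m n : ℕ) → List (Subset m)
Fpts m n = filterᵇ (λ A → ∣ A ∣ ≡ᵇ n) (subsets m)

NV : (m n : ℕ) → ℕ
NV m n = length (Fpts m n)

pt : (m n : ℕ) → Fin (NV m n) → Subset m
pt m n = lookup (Fpts m n)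

-- Vietoris–Rips complex VR(F_n^[m]; r): a simplex with j vertices is
-- encoded as a strictly increasing j-tuple of point indices whose points
-- are pairwise at distance ≤ r.  For j = 0 we get exactly one "empty
-- simplex", which gives the augmented chain complex (reduced homology).

allVecs : (j N : ℕ) → List (Vec (Fin N) j)
allVecs zero    N = [ []ᵥ ]
allVecs (suc j) N = concatMap (λ i → map (i ∷ᵥ_) (allVecs j N)) (allFin N)

increasingᵇ : {N : ℕ} → List (Fin N) → Bool
increasingᵇ []           = true
increasingᵇ (x ∷ [])     = true
increasingᵇ (x ∷ y ∷ xs) = (toℕ x <ᵇ toℕ y) ∧ increasingᵇ (y ∷ xs)

allᵇ : {A : Set} → (A → Bool) → List A → Bool
allᵇ p []       = true
allᵇ p (x ∷ xs) = p x ∧ allᵇ p xs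

pairwiseᵇ : {A : Set} → (A → A → Bool) → List A → Bool
pairwiseᵇ R []       = true
pairwiseᵇ R (x ∷ xs) = allᵇ (R x) xs ∧ pairwiseᵇ R xs

Simp : (m n r j : ℕ) → List (Vec (Fin (NV m n)) j)
Simp m n r j = filterᵇ ok (allVecs j (NV m n))
  where
  ok : Vec (Fin (NV m n)) j → Bool
  ok v = increasingᵇ (toList v)
       ∧ pairwiseᵇ (λ a b → symDist (pt m n a) (pt m n b) ≤ᵇ r) (toList v)

NS : (m n r j : ℕ) → ℕ
NS m n r j = length (Simp m n r j)

simp : (m n r j : ℕ) → Fin (NS m n r j) → Vec (Fin (NV m n)) j
simp m n r j = lookup (Simp m n r j)

Chain : (m n r j : ℕ) → Set
Chain m n r j = Fin (NS m n r j) → ℚ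

ΣF : (k : ℕ) → (Fin k → ℚ) → ℚ
ΣF zero    f = 0ℚ
ΣF (suc k) f = f Fin.zero +ℚ ΣF k (λ i → f (Fin.suc i))

sign : {k : ℕ} → Fin k → ℚ
sign i = if (toℕ i Data.Nat.% 2) ≡ᵇ 0 then 1ℚ else - 1ℚ

incidence : (m n r j : ℕ) → Fin (NS m n r j) → Fin (NS m n r (suc j)) → ℚ
incidence m n r j τ σ =
  ΣF (suc j) (λ i → if ⌊ ≡-dec _≟ᶠ_ (removeAt (simp m n r (suc j) σ) i) (simp m n r j τ) ⌋
                     then sign i else 0ℚ)

∂ : (m n r j : ℕ) → Chain m n r (suc j) → Chain m n r j
∂ m n r j c τ = ΣF (NS m n r (suc j)) (λ σ → incidence m n r j τ σ *ℚ c σ)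

-- Reduced homology H̃_q = Z_q / B_q, with Z_q = ker ∂_q ⊆ C_q and
-- B_q = im ∂_{q+1}; q-simplices have q+1 vertices.

IsCycle : (m n r q : ℕ) → Chain m n r (suc q) → Set
IsCycle m n r q z = ∀ τ → ∂ m n r q z τ ≡ 0ℚ

IsBoundary : (m n r q : ℕ) → Chain m n r (suc q) → Set
IsBoundary m n r q x = Σ (Chain m n r (suc (suc q))) λ y → ∀ τ → x τ ≡ ∂ m n r (suc q) y τ

lincomb : {A : Set} (k : ℕ) → (Fin k → ℚ) → (Fin k → A → ℚ) → A → ℚ
lincomb k c v τ = ΣF k (λ i → c i *ℚ v i τ)

-- rank H̃_q(VR(X; r)) = d : the classes of some d cycles form a basis of Z_q / B_q
HomRank : (m n r q d : ℕ) → Set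
HomRank m n r q d =
  Σ (Fin d → Chain m n r (suc q)) λ v →
      (∀ i → IsCycle m n r q (v i))
    × (∀ (c : Fin d → ℚ) → IsBoundary m n r q (lincomb d c v) → ∀ i → c i ≡ 0ℚ)
    × (∀ z → IsCycle m n r q z →
         Σ (Fin d → ℚ) λ c → Σ (Chain m n r (suc (suc q))) λ y →
           ∀ τ → z τ ≡ lincomb d c v τ +ℚ ∂ m n r (suc q) y τ)

KRank : (n m q d : ℕ) → Set
KRank n m q d = HomRank m n (2 * (n ∸ 1)) q d

{-# OPTIONS --safe #-}

-- Two n-subsets are within distance 2 (n − 1) iff they meet, so every map φ : [m] → [m′] with n ≤ m′ induces a
-- simplicial map A ↦ φ(A), enlarged to n elements; any two choices of enlargement are contiguous, which makes the
-- induced map on homology functorial in φ. For i = 1, …, ℓ let ιᵢ : [ℓ] → [ℓ + 1] skip the element i and let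
-- ρᵢ : [ℓ + 1] → [ℓ] be its left inverse sending i to the least element 0. Then ρᵢ ιᵢ = id, whereas for i ≠ j the map
-- ρᵢ ιⱼ is not surjective and factors through [ℓ − 1], whose complex has no homology in degree q
-- (ℓ = n being excluded because the complex on [n] is a single point). Hence the ιᵢ embed ℓ independent copies of H̃_q
-- of the complex on [ℓ] in that of the complex on [ℓ + 1].

module Submission where

open import Defs
open import Data.Bool.Base using (Bool; _∧_; true; false; T; if_then_else_)
open import Data.Bool.Properties using (T-∧)
open import Data.Empty using (⊥; ⊥-elim)
open import Data.Fin.Base as Fin using (Fin; zero; suc; punchIn; punchOut; toℕ)
open import Data.Fin.Properties as Finₚ using (<-cmp)
open import Data.Fin.Subset as Subset using (Subset; ∣_∣; _∩_; _∪_; ⁅_⁆)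
import Data.Fin.Subset.Properties as Subsetₚ
open import Data.List.Base using (List; []; _∷_; lookup; cartesianProductWith; concatMap; map; allFin; length; _++_)
open import Data.List.Membership.Propositional using (_∈_)
open import Data.List.Membership.Propositional.Properties
  using (∈-filter⁺; ∈-filter⁻; ∈-lookup; ∈-map⁺; ∈-++⁺ˡ; ∈-++⁺ʳ; ∈-allFin; ∈-cartesianProductWith⁺)
open import Data.List.Properties using () renaming (≡-dec to List-≡-dec)
open import Data.List.Relation.Unary.All as All using ([]; _∷_)
open import Data.List.Relation.Unary.AllPairs using ([]; _∷_)
open import Data.List.Relation.Unary.Any as Any using (here; there)
open import Data.List.Relation.Unary.Any.Properties using (lookup-index)
open import Data.List.Relation.Unary.Unique.Propositional using (Unique)
open import Data.List.Relation.Unary.Unique.Propositional.Properties using (filter⁺; allFin⁺; cartesianProductWith⁺)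
open import Data.Nat.Base as ℕ using (ℕ; zero; suc; pred; _≤ᵇ_; _<ᵇ_; _≡ᵇ_; z≤n; s≤s)
import Data.Nat.Properties as ℕₚ
import Data.Nat.Tactic.RingSolver as ℕ-Ring
open import Data.Product.Base using (Σ; ∃; _×_; _,_; proj₁; proj₂)
open import Data.Rational.Base using (ℚ; 0ℚ; 1ℚ; 1/_; ≢-nonZero)
open import Data.Rational.Properties as ℚₚ using (_≟_)
open import Data.Rational.Solver using (module +-*-Solver)
open import Data.Sum.Base using (inj₁; inj₂)
open import Data.Unit.Base using (⊤; tt)
open import Data.Vec.Base using (Vec; toList; fromList; removeAt; here; there) renaming ([] to []ᵥ; _∷_ to _∷ᵥ_)
open import Data.Vec.Properties using (toList∘fromList; length-toList) renaming (≡-dec to Vec-≡-dec; ∷-injective to ∷ᵥ-injective)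
open import Function.Base using (_∘_; case_of_; id)
open import Function.Bundles using (Equivalence)
open import Relation.Binary.Definitions using (tri<; tri≈; tri>)
open import Relation.Binary.PropositionalEquality
open import Relation.Nullary using (¬_; ¬?; yes; no; contradiction)
open import Relation.Nullary.Decidable using (T?; ⌊_⌋; decidable-stable)
open ≡-Reasoning
open +-*-Solver using (solve; _:=_; _:+_; _:*_; _:-_; :-_; con)

-- Chains enter through the functionals they define on cochains, and a cochain is any function on
-- lists of vertices. A chain map becomes a family of functionals `at t`, composed like
-- continuations, and the enumerated simplices matter only when this is translated into the matrices
-- of the statement. The price is that identities hold only on the relevant lists, so linearity and
-- support travel together in `LinearOn`. The image of an ordered simplex may be unordered or have
-- repetitions. Exterior products absorb both, and the single rule ∂ (v ∧ u) = u - v ∧ ∂ u serves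
-- for pushforwards, cones and homotopies alike. No quotient space is formed. If the rank over
-- [ℓ + 1] were too small, the images of a basis under the ιᵢ would satisfy a nontrivial relation
-- modulo boundaries; applying ρᵢ isolates the i-th block of its coefficients, and independence over
-- [ℓ] makes that block vanish.

module IntersectingFamilies where

  open import Data.Rational.Base using (_+_; _*_; _-_; -_)
  open import Data.Fin.Base using (_<_)

  -- Finite sums

  ΣF-cong : ∀ k {f g : Fin k → ℚ} → (∀ i → f i ≡ g i) → ΣF k f ≡ ΣF k g
  ΣF-cong zero    e = refl
  ΣF-cong (suc k) e = cong₂ _+_ (e zero) (ΣF-cong k (e ∘ suc))

  ΣF-zero : ∀ k {f : Fin k → ℚ} → (∀ i → f i ≡ 0ℚ) → ΣF k f ≡ 0ℚ
  ΣF-zero zero    e = refl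
  ΣF-zero (suc k) e = trans (cong₂ _+_ (e zero) (ΣF-zero k (e ∘ suc))) (ℚₚ.+-identityʳ 0ℚ)

  ΣF-+ : ∀ k (f g : Fin k → ℚ) → ΣF k (λ i → f i + g i) ≡ ΣF k f + ΣF k g
  ΣF-+ zero    f g = refl
  ΣF-+ (suc k) f g = trans (cong (f zero + g zero +_) (ΣF-+ k (f ∘ suc) (g ∘ suc)))
    (solve 4 (λ a b c d → (a :+ b) :+ (c :+ d) := (a :+ c) :+ (b :+ d)) refl
      (f zero) (g zero) (ΣF k (f ∘ suc)) (ΣF k (g ∘ suc)))

  ΣF-*ˡ : ∀ k a (f : Fin k → ℚ) → ΣF k (λ i → a * f i) ≡ a * ΣF k f
  ΣF-*ˡ zero    a f = sym (ℚₚ.*-zeroʳ a)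
  ΣF-*ˡ (suc k) a f = trans (cong (a * f zero +_) (ΣF-*ˡ k a (f ∘ suc)))
    (sym (ℚₚ.*-distribˡ-+ a (f zero) (ΣF k (f ∘ suc))))

  ΣF-*ʳ : ∀ k a (f : Fin k → ℚ) → ΣF k (λ i → f i * a) ≡ ΣF k f * a
  ΣF-*ʳ k a f = begin
    ΣF k (λ i → f i * a) ≡⟨ ΣF-cong k (λ i → ℚₚ.*-comm (f i) a) ⟩
    ΣF k (λ i → a * f i) ≡⟨ ΣF-*ˡ k a f ⟩
    a * ΣF k f           ≡⟨ ℚₚ.*-comm a (ΣF k f) ⟩
    ΣF k f * a           ∎

  ΣF-neg : ∀ k (f : Fin k → ℚ) → ΣF k (λ i → - f i) ≡ - ΣF k f
  ΣF-neg zero    f = refl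
  ΣF-neg (suc k) f = trans (cong (- f zero +_) (ΣF-neg k (f ∘ suc)))
    (sym (ℚₚ.neg-distrib-+ (f zero) (ΣF k (f ∘ suc))))

  ΣF-sub : ∀ k (f g : Fin k → ℚ) → ΣF k (λ i → f i - g i) ≡ ΣF k f - ΣF k g
  ΣF-sub k f g = trans (ΣF-+ k f (λ i → - g i)) (cong (ΣF k f +_) (ΣF-neg k g))

  ΣF-swap : ∀ k l (f : Fin k → Fin l → ℚ) →
            ΣF k (λ i → ΣF l (f i)) ≡ ΣF l (λ j → ΣF k (λ i → f i j))
  ΣF-swap zero    l f = sym (ΣF-zero l (λ _ → refl))
  ΣF-swap (suc k) l f = trans (cong (ΣF l (f zero) +_) (ΣF-swap k l (f ∘ suc)))
    (sym (ΣF-+ l (f zero) (λ j → ΣF k (λ i → f (suc i) j))))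

  ΣF-single : ∀ {k} (i : Fin k) {f : Fin k → ℚ} → (∀ j → i ≢ j → f j ≡ 0ℚ) → ΣF k f ≡ f i
  ΣF-single {suc k} zero {f} e = trans (cong (f zero +_) (ΣF-zero k (λ j → e (suc j) (λ ()))))
    (ℚₚ.+-identityʳ (f zero))
  ΣF-single (suc i) {f} e = trans
    (cong₂ _+_ (e zero (λ ())) (ΣF-single i (λ j i≢j → e (suc j) (i≢j ∘ Finₚ.suc-injective))))
    (ℚₚ.+-identityˡ (f (suc i)))

  ΣF-++ : ∀ k l (f : Fin (k ℕ.+ l) → ℚ) →
          ΣF (k ℕ.+ l) f ≡ ΣF k (λ i → f (i Fin.↑ˡ l)) + ΣF l (λ j → f (k Fin.↑ʳ j))
  ΣF-++ zero    l f = sym (ℚₚ.+-identityˡ (ΣF l f))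
  ΣF-++ (suc k) l f = trans (cong (f zero +_) (ΣF-++ k l (f ∘ suc)))
    (sym (ℚₚ.+-assoc (f zero) (ΣF k (λ i → f (suc i Fin.↑ˡ l))) (ΣF l (λ j → f (suc k Fin.↑ʳ j)))))

  ΣF-combine : ∀ k l (f : Fin (k ℕ.* l) → ℚ) →
               ΣF (k ℕ.* l) f ≡ ΣF k (λ i → ΣF l (λ j → f (Fin.combine i j)))
  ΣF-combine zero    l f = refl
  ΣF-combine (suc k) l f = trans (ΣF-++ l (k ℕ.* l) f)
    (cong (ΣF l (λ j → f (j Fin.↑ˡ (k ℕ.* l))) +_) (ΣF-combine k l (f ∘ (l Fin.↑ʳ_))))

  x*y≡0⇒y≡0 : ∀ {x y} → x ≢ 0ℚ → x * y ≡ 0ℚ → y ≡ 0ℚ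
  x*y≡0⇒y≡0 {x} {y} x≢0 xy≡0 = begin
    y              ≡⟨ sym (ℚₚ.*-identityˡ y) ⟩
    1ℚ * y         ≡⟨ cong (_* y) (sym (ℚₚ.*-inverseˡ x)) ⟩
    1/ x * x * y   ≡⟨ ℚₚ.*-assoc (1/ x) x y ⟩
    1/ x * (x * y) ≡⟨ cong (1/ x *_) xy≡0 ⟩
    1/ x * 0ℚ      ≡⟨ ℚₚ.*-zeroʳ (1/ x) ⟩
    0ℚ             ∎
    where instance _ = ≢-nonZero x≢0

  -- Gaussian elimination, with a nonzero entry of the head vector as pivot.
  dependent : ∀ {b k} → b ℕ.< k → (M : Fin k → Fin b → ℚ) →
              Σ (Fin k → ℚ) λ c → (∃ λ i → c i ≢ 0ℚ) × (∀ j → ΣF k (λ i → c i * M i j) ≡ 0ℚ)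
  dependent {b} {suc k} b<k M with Finₚ.any? (λ p → ¬? (M zero p ≟ 0ℚ))
  ... | no  allZero = c , (zero , λ ()) , λ j → begin
      ΣF (suc k) (λ i → c i * M i j)
        ≡⟨ ΣF-single zero {λ i → c i * M i j} (λ { zero 0≢0 → ⊥-elim (0≢0 refl) ; (suc i) _ → ℚₚ.*-zeroˡ (M (suc i) j) }) ⟩
      1ℚ * M zero j                   ≡⟨ ℚₚ.*-identityˡ (M zero j) ⟩
      M zero j                        ≡⟨ decidable-stable (M zero j ≟ 0ℚ) (λ ≢0 → allZero (j , ≢0)) ⟩
      0ℚ                              ∎
    where
    c : Fin (suc k) → ℚ
    c zero    = 1ℚ
    c (suc _) = 0ℚ
  dependent {suc b} {suc k} (ℕ.s≤s b<k) M | yes (p , pivot≢0) = c , (suc i₀ , c≢0) , vanish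
    where
    x = M zero p
    y = λ i → M (suc i) p

    reduced : Fin k → Fin b → ℚ
    reduced i j = x * M (suc i) (punchIn p j) - y i * M zero (punchIn p j)

    ih = dependent b<k reduced
    c′ = proj₁ ih
    i₀ = proj₁ (proj₁ (proj₂ ih))

    s = ΣF k (λ i → c′ i * y i)

    c : Fin (suc k) → ℚ
    -- Scaling the other coefficients by the pivot keeps the row operation free of division; `- s`
    -- then cancels column `p`.
    c zero    = - s
    c (suc i) = x * c′ i

    c≢0 : x * c′ i₀ ≢ 0ℚ
    c≢0 e = proj₂ (proj₁ (proj₂ ih)) (x*y≡0⇒y≡0 pivot≢0 e)

    expand : ∀ j → ΣF (suc k) (λ i → c i * M i j) ≡ - s * M zero j + ΣF k (λ i → c′ i * (x * M (suc i) j))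
    expand j = cong (- s * M zero j +_) (ΣF-cong k λ i →
      solve 3 (λ a b c → (a :* b) :* c := b :* (a :* c)) refl x (c′ i) (M (suc i) j))

    vanish : ∀ j → ΣF (suc k) (λ i → c i * M i j) ≡ 0ℚ
    vanish j with p Finₚ.≟ j
    ... | yes refl = begin
      ΣF (suc k) (λ i → c i * M i p)                    ≡⟨ expand p ⟩
      - s * x + ΣF k (λ i → c′ i * (x * y i))
        ≡⟨ cong (- s * x +_) (ΣF-cong k λ i →
             solve 3 (λ a b c → a :* (b :* c) := b :* (a :* c)) refl (c′ i) x (y i)) ⟩
      - s * x + ΣF k (λ i → x * (c′ i * y i))           ≡⟨ cong (- s * x +_) (ΣF-*ˡ k x _) ⟩
      - s * x + x * s                                   ≡⟨ solve 2 (λ s x → :- s :* x :+ x :* s := con 0ℚ) refl s x ⟩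
      0ℚ                                                ∎
    ... | no p≢j = subst (λ j → ΣF (suc k) (λ i → c i * M i j) ≡ 0ℚ) (Finₚ.punchIn-punchOut p≢j) (begin
      ΣF (suc k) (λ i → c i * M i j′)                                           ≡⟨ expand j′ ⟩
      - s * M zero j′ + ΣF k (λ i → c′ i * (x * M (suc i) j′))
        ≡⟨ cong (_+ ΣF k (λ i → c′ i * (x * M (suc i) j′)))
             (solve 2 (λ s m → :- s :* m := s :* :- m) refl s (M zero j′)) ⟩
      s * (- M zero j′) + ΣF k (λ i → c′ i * (x * M (suc i) j′))
        ≡⟨ cong (_+ ΣF k (λ i → c′ i * (x * M (suc i) j′)))
             (sym (ΣF-*ʳ k (- M zero j′) _)) ⟩
      ΣF k (λ i → c′ i * y i * (- M zero j′)) + ΣF k (λ i → c′ i * (x * M (suc i) j′)) ≡⟨ sym (ΣF-+ k _ _) ⟩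
      ΣF k (λ i → c′ i * y i * (- M zero j′) + c′ i * (x * M (suc i) j′))
        ≡⟨ ΣF-cong k (λ i →
             solve 5 (λ c y m x n → c :* y :* :- m :+ c :* (x :* n) := c :* (x :* n :- y :* m)) refl
               (c′ i) (y i) (M zero j′) x (M (suc i) j′)) ⟩
      ΣF k (λ i → c′ i * reduced i (punchOut p≢j))                              ≡⟨ proj₂ (proj₂ ih) (punchOut p≢j) ⟩
      0ℚ                                                                        ∎)
      where j′ = punchIn p (punchOut p≢j)

  -- Functionals and their supports

  -- Defined on all lists, so that `φ ∘ (x ∷_)` is again a cochain; values off the simplices are
  -- made harmless by `LinearOn`.
  Cochain : Set → Set
  Cochain V = List V → ℚ

  Functional : Set → Set
  Functional V = Cochain V → ℚ

  -- L is a finite linear combination of evaluations at lists satisfying S.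
  LinearOn : {V : Set} → (List V → Set) → Functional V → Set
  LinearOn S L = ∀ k (c : Fin k → ℚ) Φ φ →
    (∀ u → S u → φ u ≡ lincomb k c Φ u) → L φ ≡ ΣF k (λ i → c i * L (Φ i))

  module _ {V : Set} {S : List V → Set} where

    lin-eval : ∀ {u} → S u → LinearOn S (λ φ → φ u)
    lin-eval {u} Su k c Φ φ e = e u Su

    lin-zero : LinearOn S (λ _ → 0ℚ)
    lin-zero k c Φ φ e = sym (ΣF-zero k (λ i → ℚₚ.*-zeroʳ (c i)))

    lin-neg : ∀ {L} → LinearOn S L → LinearOn S (λ φ → - L φ)
    lin-neg {L} l k c Φ φ e = begin
      - L φ                          ≡⟨ cong -_ (l k c Φ φ e) ⟩
      - ΣF k (λ i → c i * L (Φ i))   ≡⟨ sym (ΣF-neg k _) ⟩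
      ΣF k (λ i → - (c i * L (Φ i))) ≡⟨ ΣF-cong k (λ i → ℚₚ.neg-distribʳ-* (c i) (L (Φ i))) ⟩
      ΣF k (λ i → c i * - L (Φ i))   ∎

    lin-sub : ∀ {L L′} → LinearOn S L → LinearOn S L′ → LinearOn S (λ φ → L φ - L′ φ)
    lin-sub {L} {L′} l l′ k c Φ φ e = begin
      L φ - L′ φ                                             ≡⟨ cong₂ _-_ (l k c Φ φ e) (l′ k c Φ φ e) ⟩
      ΣF k (λ i → c i * L (Φ i)) - ΣF k (λ i → c i * L′ (Φ i)) ≡⟨ sym (ΣF-sub k _ _) ⟩
      ΣF k (λ i → c i * L (Φ i) - c i * L′ (Φ i))
        ≡⟨ ΣF-cong k (λ i → solve 3 (λ a b c → a :* b :- a :* c := a :* (b :- c)) refl (c i) (L (Φ i)) (L′ (Φ i))) ⟩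
      ΣF k (λ i → c i * (L (Φ i) - L′ (Φ i)))                ∎

    lin-mono : ∀ {S′ : List V → Set} {L} → (∀ u → S u → S′ u) → LinearOn S L → LinearOn S′ L
    lin-mono S⊆S′ l k c Φ φ e = l k c Φ φ (λ u Su → e u (S⊆S′ u Su))

    -- Composition of linear maps in functional form: each list in the support of `L` is replaced by
    -- a combination of lists in `S′`.
    lin-bind : ∀ {V′ : Set} {S′ : List V′ → Set} {L} {F : List V → Functional V′} → LinearOn S L →
               (∀ u → S u → LinearOn S′ (F u)) → LinearOn S′ (λ φ → L (λ u → F u φ))
    lin-bind {F = F} l f k c Φ φ e = l k c (λ i u → F u (Φ i)) _ (λ u Su → f u Su k c Φ φ e)

    module _ {L : Functional V} (l : LinearOn S L) where

      lin-comb₂ : ∀ a b {φ ψ χ} → (∀ u → S u → φ u ≡ a * ψ u + b * χ u) → L φ ≡ a * L ψ + b * L χ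
      lin-comb₂ a b {φ} {ψ} {χ} e = trans
        (l 2 c Φ φ (λ u Su → trans (e u Su) (cong (a * ψ u +_) (sym (ℚₚ.+-identityʳ (b * χ u))))))
        (cong (a * L ψ +_) (ℚₚ.+-identityʳ (b * L χ)))
        where
        c : Fin 2 → ℚ
        c zero    = a
        c (suc _) = b
        Φ : Fin 2 → Cochain V
        Φ zero    = ψ
        Φ (suc _) = χ

      app-sub : ∀ {φ ψ χ} → (∀ u → S u → φ u ≡ ψ u - χ u) → L φ ≡ L ψ - L χ
      app-sub {φ} {ψ} {χ} e = trans (lin-comb₂ 1ℚ (- 1ℚ) (λ u Su → trans (e u Su) (sym (lem (ψ u) (χ u)))))
        (lem (L ψ) (L χ))
        where
        lem : ∀ x y → 1ℚ * x + - 1ℚ * y ≡ x - y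
        lem = solve 2 (λ x y → con 1ℚ :* x :+ con (- 1ℚ) :* y := x :- y) refl

      app-zero : ∀ {φ} → (∀ u → S u → φ u ≡ 0ℚ) → L φ ≡ 0ℚ
      app-zero {φ} e = l 0 (λ ()) (λ ()) φ e

      app-cong : ∀ {φ ψ} → (∀ u → S u → φ u ≡ ψ u) → L φ ≡ L ψ
      app-cong {φ} {ψ} e = trans (l 1 (λ _ → 1ℚ) (λ _ → ψ) φ (λ u Su → trans (e u Su) (sym (lem (ψ u))))) (lem (L ψ))
        where
        lem : ∀ x → 1ℚ * x + 0ℚ ≡ x
        lem = solve 1 (λ x → con 1ℚ :* x :+ con 0ℚ := x) refl

      app-neg : ∀ {φ ψ} → (∀ u → S u → φ u ≡ - ψ u) → L φ ≡ - L ψ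
      app-neg {φ} {ψ} e = trans (l 1 (λ _ → - 1ℚ) (λ _ → ψ) φ (λ u Su → trans (e u Su) (sym (lem (ψ u))))) (lem (L ψ))
        where
        lem : ∀ x → - 1ℚ * x + 0ℚ ≡ - x
        lem = solve 1 (λ x → con (- 1ℚ) :* x :+ con 0ℚ := :- x) refl

  -- Strictly increasing lists

  -- The predicate gains a lower bound at each entry, so one recursion records length, support and
  -- order. An increasing list names a basis vector of the exterior algebra.
  Asc : ∀ {N} → (Fin N → Set) → ℕ → List (Fin N) → Set
  Asc C zero    []      = ⊤
  Asc C (suc j) (x ∷ s) = C x × Asc (λ y → C y × x < y) j s
  Asc C _       _       = ⊥

  module _ {N : ℕ} where

    private V = Fin N

    asc-all : ∀ {C : V → Set} j {u} → Asc C j u → ∀ {y} → y ∈ u → C y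
    asc-all (suc j) {x ∷ s} (Cx , p) (here refl) = Cx
    asc-all (suc j) {x ∷ s} (Cx , p) (there y∈s) = proj₁ (asc-all j p y∈s)

    asc-restrict : ∀ {C D : V → Set} j {u} → (∀ {y} → y ∈ u → D y) → Asc C j u → Asc D j u
    asc-restrict zero    {[]}    D⊇u p        = tt
    asc-restrict (suc j) {x ∷ s} D⊇u (Cx , p) =
      D⊇u (here refl) , asc-restrict j (λ y∈s → D⊇u (there y∈s) , proj₂ (asc-all j p y∈s)) p

    asc-mono : ∀ {C D : V → Set} j {u} → (∀ y → C y → D y) → Asc C j u → Asc D j u
    asc-mono j C⊆D p = asc-restrict j (λ {y} y∈u → C⊆D y (asc-all j p y∈u)) p

    -- δ φ t is the value of φ on the boundary of t.
    δ : Cochain V → Cochain V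
    δ φ []      = 0ℚ
    δ φ (x ∷ s) = φ s - δ (φ ∘ (x ∷_)) s

    δ-lin : ∀ {C : V → Set} j {t} → Asc C j t → LinearOn (Asc C (pred j)) (λ φ → δ φ t)
    δ-lin zero          {[]}         _        = lin-zero
    δ-lin (suc zero)    {x ∷ []}     _        = lin-sub (lin-eval tt) lin-zero
    δ-lin (suc (suc j)) {x ∷ s}      (Cx , p) =
      lin-sub (lin-eval (asc-mono (suc j) (λ _ → proj₁) p))
              (lin-bind (δ-lin (suc j) p) (λ u q → lin-eval (Cx , q)))

    -- In ∂ (x ∧ s) = s - x ∧ ∂ s the two copies of ∂ s cancel and x ∧ ∂ ∂ s vanishes by induction,
    -- with no double sum over pairs of faces.
    δ∘δ : ∀ φ {j t} → Asc (λ _ → ⊤) j t → δ (δ φ) t ≡ 0ℚ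
    δ∘δ φ {zero}  {[]}    _ = refl
    δ∘δ φ {suc j} {x ∷ s} p = begin
      δ φ s - δ (λ w → φ w - δ (φ ∘ (x ∷_)) w) s   ≡⟨ cong (λ e → δ φ s - e) (app-sub (δ-lin j s↑) (λ _ _ → refl)) ⟩
      δ φ s - (δ φ s - δ (δ (φ ∘ (x ∷_))) s)       ≡⟨ cong (λ e → δ φ s - (δ φ s - e)) (δ∘δ (φ ∘ (x ∷_)) s↑) ⟩
      δ φ s - (δ φ s - 0ℚ)                         ≡⟨ solve 1 (λ a → a :- (a :- con 0ℚ) := con 0ℚ) refl (δ φ s) ⟩
      0ℚ                                           ∎
      where s↑ = asc-mono j (λ _ _ → tt) (proj₂ p)

    -- Evaluation at the exterior product v ∧ u, for increasing u.
    wedge : V → List V → Functional V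
    wedge v []      = λ φ → φ (v ∷ [])
    wedge v (x ∷ s) with <-cmp v x
    ... | tri< _ _ _ = λ φ → φ (v ∷ x ∷ s)
    ... | tri≈ _ _ _ = λ φ → 0ℚ
    ... | tri> _ _ _ = λ φ → - wedge v s (φ ∘ (x ∷_))

    wedge-lin : ∀ {C : V → Set} {v} j {u} → C v → Asc C j u → LinearOn (Asc C (suc j)) (wedge v u)
    wedge-lin         zero    {[]}    Cv _        = lin-eval (Cv , tt)
    wedge-lin {C} {v} (suc j) {x ∷ s} Cv (Cx , p) with <-cmp v x
    ... | tri< v<x _ _ = lin-eval (Cv , (Cx , v<x) ,
                           asc-mono j (λ y (Cy , x<y) → (Cy , Finₚ.<-trans v<x x<y) , x<y) p)
    ... | tri≈ _ _ _   = lin-zero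
    ... | tri> _ _ x<v = lin-neg (lin-bind (wedge-lin j (Cv , x<v) p) (λ u q → lin-eval (Cx , q)))

    wedge-below : ∀ {v} j {u} → Asc (v <_) j u → ∀ φ → wedge v u φ ≡ φ (v ∷ u)
    wedge-below     zero    {[]}    _         φ = refl
    wedge-below {v} (suc j) {x ∷ s} (v<x , _) φ with <-cmp v x
    ... | tri< _ _ _   = refl
    ... | tri≈ v≮x _ _ = ⊥-elim (v≮x v<x)
    ... | tri> v≮x _ _ = ⊥-elim (v≮x v<x)

    wedge-head : ∀ x s φ → wedge x (x ∷ s) φ ≡ 0ℚ
    wedge-head x s φ with <-cmp x x
    ... | tri< _ x≢x _ = ⊥-elim (x≢x refl)
    ... | tri≈ _ _ _   = refl
    ... | tri> _ x≢x _ = ⊥-elim (x≢x refl)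

    wedge-above : ∀ {v x} → x < v → ∀ s φ → wedge v (x ∷ s) φ ≡ - wedge v s (φ ∘ (x ∷_))
    wedge-above {v} {x} x<v s φ with <-cmp v x
    ... | tri< _ _ x≮v = ⊥-elim (x≮v x<v)
    ... | tri≈ _ _ x≮v = ⊥-elim (x≮v x<v)
    ... | tri> _ _ _   = refl

    -- ∂ (v ∧ u) = u − v ∧ ∂ u
    wedge-δ : ∀ v φ {j u} → Asc (λ _ → ⊤) j u → wedge v u (δ φ) ≡ φ u - δ (λ w → wedge v w φ) u
    wedge-δ v φ {zero}  {[]}    _ = refl
    wedge-δ v φ {suc j} {x ∷ s} (_ , q) = case <-cmp v x of λ where
        (tri< v<x _ _) →
          let v<u = v<x , asc-mono j (λ y (_ , x<y) → Finₚ.<-trans v<x x<y , x<y) q in begin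
          wedge v (x ∷ s) (δ φ)
            ≡⟨ wedge-below (suc j) v<u (δ φ) ⟩
          φ (x ∷ s) - δ (φ ∘ (v ∷_)) (x ∷ s)
            ≡⟨ cong (λ e → φ (x ∷ s) - e) (sym (app-cong (δ-lin (suc j) v<u) (λ w w↑ → wedge-below j w↑ φ))) ⟩
          φ (x ∷ s) - δ (λ w → wedge v w φ) (x ∷ s) ∎
        -- The product on the left is degenerate. On the right, the only face of `x ∷ s` that
        -- survives multiplication by `x` is `s`, and it gives `x ∷ s` back.
        (tri≈ _ refl _) → begin
          wedge x (x ∷ s) (δ φ)
            ≡⟨ wedge-head x s (δ φ) ⟩
          0ℚ
            ≡⟨ solve 1 (λ a → con 0ℚ := a :- (a :- con 0ℚ)) refl (φ (x ∷ s)) ⟩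
          φ (x ∷ s) - (φ (x ∷ s) - 0ℚ)
            ≡⟨ cong₂ (λ a b → φ (x ∷ s) - (a - b))
                 (sym (wedge-below j (asc-mono j (λ _ → proj₂) q) φ))
                 (sym (app-zero (δ-lin j q) (λ w _ → wedge-head x w φ))) ⟩
          φ (x ∷ s) - (wedge x s φ - δ (λ w → wedge x (x ∷ w) φ) s) ∎
        (tri> _ _ x<v) → begin
          wedge v (x ∷ s) (δ φ)
            ≡⟨ wedge-above x<v s (δ φ) ⟩
          - wedge v s (λ w → φ w - δ φₓ w)
            ≡⟨ cong -_ (app-sub (wedge-lin j tt s↑) (λ _ _ → refl)) ⟩
          - (wedge v s φ - wedge v s (δ φₓ))
            ≡⟨ cong (λ e → - (wedge v s φ - e)) (wedge-δ v φₓ s↑) ⟩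
          - (wedge v s φ - (φ (x ∷ s) - δ (λ w → wedge v w φₓ) s))
            ≡⟨ solve 3 (λ a b c → :- (b :- (a :- c)) := a :- (b :- :- c)) refl (φ (x ∷ s)) (wedge v s φ) (δ (λ w → wedge v w φₓ) s) ⟩
          φ (x ∷ s) - (wedge v s φ - - δ (λ w → wedge v w φₓ) s)
            ≡⟨ cong (λ e → φ (x ∷ s) - (wedge v s φ - e)) (sym (app-neg (δ-lin j q) (λ w _ → wedge-above x<v w φ))) ⟩
          φ (x ∷ s) - (wedge v s φ - δ (λ w → wedge v (x ∷ w) φ) s) ∎
      where
      φₓ = φ ∘ (x ∷_)
      s↑ = asc-mono j (λ _ _ → tt) q

  -- Chain maps with a carrier

  Increasing : ∀ {N} → ℕ → List (Fin N) → Set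
  Increasing = Asc (λ _ → ⊤)

  -- The vertices allowed in the image of `t`. That they span a simplex of the target is left to
  -- `carrier-simplex`, which keeps the homotopy argument about increasing lists alone.
  Carrier : ∀ {N N′} → (Fin N → Fin N′ → Set) → List (Fin N) → Fin N′ → Set
  Carrier K t y = ∃ λ x → x ∈ t × K x y

  -- An augmentation-preserving chain map, given by the functionals evaluating cochains
  -- on the images of the increasing lists.
  record ChainMap {N N′ : ℕ} (K : Fin N → Fin N′ → Set) : Set where
    field
      at      : List (Fin N) → Functional (Fin N′)
      at-[]   : ∀ φ → at [] φ ≡ φ []
      at-δ    : ∀ φ {j t} → Increasing j t → at t (δ φ) ≡ δ (λ s → at s φ) t
      carried : ∀ j {t} → Increasing j t → LinearOn (Asc (Carrier K t) j) (at t)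

  open ChainMap public

  module _ {N N′ : ℕ} {K : Fin N → Fin N′ → Set} where

    -- Evaluation at the exterior product of the images `f x`: repeated images give 0, and unordered
    -- ones the sign of the sorting permutation.
    pull : (Fin N → Fin N′) → List (Fin N) → Functional (Fin N′)
    pull f []      φ = φ []
    pull f (x ∷ s) φ = pull f s (λ u → wedge (f x) u φ)

    module _ {f : Fin N → Fin N′} (Kf : ∀ x → K x (f x)) where

      pull-lin : ∀ j {t} → Increasing j t → LinearOn (Asc (Carrier K t) j) (pull f t)
      pull-lin zero    {[]}    _       = lin-eval tt
      pull-lin (suc j) {x ∷ s} (_ , p) = lin-bind (pull-lin j (asc-mono j (λ _ _ → tt) p)) λ u q →
        wedge-lin j (x , here refl , Kf x) (asc-mono j (λ y (x′ , x′∈s , k) → x′ , there x′∈s , k) q)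

      -- `wedge-δ` reproduces the recursion that defines `δ`, with `f x` in place of `x`.
      pull-δ : ∀ φ {j t} → Increasing j t → pull f t (δ φ) ≡ δ (λ s → pull f s φ) t
      pull-δ φ {zero}  {[]}    _       = refl
      pull-δ φ {suc j} {x ∷ s} (_ , p) = begin
        pull f s (λ u → wedge (f x) u (δ φ))
          ≡⟨ app-sub (pull-lin j s↑) (λ u q → wedge-δ (f x) φ (asc-mono j (λ _ _ → tt) q)) ⟩
        pull f s φ - pull f s (δ (λ w → wedge (f x) w φ))
          ≡⟨ cong (λ e → pull f s φ - e) (pull-δ (λ w → wedge (f x) w φ) s↑) ⟩
        pull f s φ - δ (λ w → pull f (x ∷ w) φ) s ∎
        where s↑ = asc-mono j (λ _ _ → tt) p

      pushforward : ChainMap K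
      pushforward = record
        { at = pull f ; at-[] = λ _ → refl ; at-δ = pull-δ ; carried = pull-lin }

  identity : ∀ {N} {K : Fin N → Fin N → Set} → (∀ x → K x x) → ChainMap K
  identity K-refl = record
    { at      = λ t φ → φ t
    ; at-[]   = λ _ → refl
    ; at-δ    = λ _ _ → refl
    ; carried = λ j p → lin-eval (asc-restrict j (λ {y} y∈t → y , y∈t , K-refl y) p)
    }

  compose : ∀ {N N′ N″} {K : Fin N → Fin N′ → Set} {K′ : Fin N′ → Fin N″ → Set} {K″ : Fin N → Fin N″ → Set} →
            (∀ {x y z} → K x y → K′ y z → K″ x z) → ChainMap K → ChainMap K′ → ChainMap K″
  compose trans-K F G = record
    { at      = λ t φ → at F t (λ u → at G u φ)
    ; at-[]   = λ φ → trans (at-[] F _) (at-[] G φ)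
    ; at-δ    = λ φ {j} p → trans
        (app-cong (carried F j p) (λ u q → at-δ G φ (asc-mono j (λ _ _ → tt) q)))
        (at-δ F (λ u → at G u φ) p)
    ; carried = λ j p → lin-bind (carried F j p) λ u q →
        lin-mono (λ w r → asc-mono j (λ z (y , y∈u , k′) → let x , x∈t , k = asc-all j q y∈u in
                                        x , x∈t , trans-K k k′) r)
                 (carried G j (asc-mono j (λ _ _ → tt) q))
    }

  -- Acyclic carriers: two chain maps with the same carrier are homotopic, since the carrier of
  -- a nonempty list t is a full simplex and hence a cone, with the image of the head of t as apex.
  module Homotopy {N N′ : ℕ} {K : Fin N → Fin N′ → Set} {f : Fin N → Fin N′} (Kf : ∀ x → K x (f x))
                  (F G : ChainMap K) where

    -- Writing h for `homotopy`, `residue` is the cycle G t - F t - h (∂ t), which h t has to bound;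
    -- h t is its cone from `f x`. The index is the length on which the mutual recursion descends,
    -- since faces are reached only through `δ`.
    homotopy : ℕ → List (Fin N) → Functional (Fin N′)
    residue  : ℕ → List (Fin N) → Functional (Fin N′)

    -- On the empty simplex both chain maps preserve the augmentation, so there is no difference to
    -- bound.
    homotopy zero    _       φ = 0ℚ
    homotopy (suc j) []      φ = 0ℚ
    homotopy (suc j) (x ∷ s) φ = residue j (x ∷ s) (λ u → wedge (f x) u φ)

    residue j t χ = at G t χ - at F t χ - δ (λ r → homotopy j r χ) t

    homotopy-lin : ∀ j {t} → Increasing j t → LinearOn (Asc (Carrier K t) (suc j)) (homotopy j t)
    residue-lin  : ∀ j {t} → Increasing (suc j) t → LinearOn (Asc (Carrier K t) (suc j)) (residue j t)

    homotopy-lin zero    {[]}    _ = lin-zero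
    homotopy-lin (suc j) {x ∷ s} p = lin-bind (residue-lin j p) λ u q →
      wedge-lin (suc j) (x , here refl , Kf x) q

    residue-lin j p = lin-sub (lin-sub (carried G (suc j) p) (carried F (suc j) p))
      (lin-bind (δ-lin (suc j) (asc-restrict (suc j) (λ y∈t → y∈t) p)) λ r q →
        lin-mono (λ w → asc-mono (suc j) (λ y (x , x∈r , k) → x , asc-all j q x∈r , k))
                 (homotopy-lin j (asc-mono j (λ _ _ → tt) q)))

    homotopy-δ : ∀ j φ {t} → Increasing j t →
                 homotopy j t (δ φ) ≡ at G t φ - at F t φ - δ (λ s → homotopy (pred j) s φ) t
    -- The boundary of h (∂ t) is G (∂ t) - F (∂ t) - h (∂ ∂ t) by the homotopy identity one
    -- dimension lower; ∂ ∂ = 0 removes the last term and the rest cancels.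
    residue-δ  : ∀ j χ {t} → Increasing (suc j) t → residue j t (δ χ) ≡ 0ℚ

    homotopy-δ zero φ {[]} _ = sym (begin
      at G [] φ - at F [] φ - 0ℚ ≡⟨ cong₂ (λ a b → a - b - 0ℚ) (at-[] G φ) (at-[] F φ) ⟩
      φ [] - φ [] - 0ℚ           ≡⟨ solve 1 (λ a → a :- a :- con 0ℚ := con 0ℚ) refl (φ []) ⟩
      0ℚ                         ∎)
    homotopy-δ (suc j) φ {x ∷ s} p = begin
      residue j (x ∷ s) (λ u → wedge (f x) u (δ φ))
        ≡⟨ app-sub (residue-lin j p) (λ u q → wedge-δ (f x) φ (asc-mono (suc j) (λ _ _ → tt) q)) ⟩
      residue j (x ∷ s) φ - residue j (x ∷ s) (δ (λ w → wedge (f x) w φ))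
        ≡⟨ cong (λ e → residue j (x ∷ s) φ - e) (residue-δ j (λ w → wedge (f x) w φ) p) ⟩
      residue j (x ∷ s) φ - 0ℚ
        ≡⟨ ℚₚ.+-identityʳ (residue j (x ∷ s) φ) ⟩
      residue j (x ∷ s) φ ∎

    residue-δ j χ {t} p = begin
      at G t (δ χ) - at F t (δ χ) - δ (λ r → homotopy j r (δ χ)) t
        ≡⟨ cong₂ _-_ (cong₂ _-_ (at-δ G χ p) (at-δ F χ p))
             (trans (app-sub t-lin (λ r q → homotopy-δ j χ q))
               (cong₂ _-_ (app-sub t-lin (λ _ _ → refl)) (δ∘δ (λ q → homotopy (pred j) q χ) p))) ⟩
      G′ - F′ - (G′ - F′ - 0ℚ)
        ≡⟨ solve 2 (λ a b → a :- b :- (a :- b :- con 0ℚ) := con 0ℚ) refl G′ F′ ⟩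
      0ℚ ∎
      where
      t-lin = δ-lin (suc j) p
      G′ = δ (λ s → at G s χ) t
      F′ = δ (λ s → at F s χ) t

  -- Close sets are those that meet

  symDist-∩ : ∀ {m} (A B : Subset m) → symDist A B ℕ.+ 2 ℕ.* ∣ A ∩ B ∣ ≡ ∣ A ∣ ℕ.+ ∣ B ∣
  symDist-∩ []ᵥ           []ᵥ           = refl
  symDist-∩ (false ∷ᵥ A)  (false ∷ᵥ B)  = symDist-∩ A B
  symDist-∩ (false ∷ᵥ A)  (true ∷ᵥ B)   = trans (cong suc (symDist-∩ A B)) (sym (ℕₚ.+-suc ∣ A ∣ ∣ B ∣))
  symDist-∩ (true ∷ᵥ A)   (false ∷ᵥ B)  = cong suc (symDist-∩ A B)
  symDist-∩ (true ∷ᵥ A)   (true ∷ᵥ B)   = begin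
    symDist A B ℕ.+ 2 ℕ.* suc ∣ A ∩ B ∣           ≡⟨ shift (symDist A B) ∣ A ∩ B ∣ ⟩
    2 ℕ.+ (symDist A B ℕ.+ 2 ℕ.* ∣ A ∩ B ∣)       ≡⟨ cong (2 ℕ.+_) (symDist-∩ A B) ⟩
    2 ℕ.+ (∣ A ∣ ℕ.+ ∣ B ∣)                       ≡⟨ cong suc (sym (ℕₚ.+-suc ∣ A ∣ ∣ B ∣)) ⟩
    suc ∣ A ∣ ℕ.+ suc ∣ B ∣                       ∎
    where
    shift : ∀ d c → d ℕ.+ 2 ℕ.* suc c ≡ 2 ℕ.+ (d ℕ.+ 2 ℕ.* c)
    shift = ℕ-Ring.solve-∀

  module _ {m n : ℕ} {A B : Subset m} (∣A∣ : ∣ A ∣ ≡ suc n) (∣B∣ : ∣ B ∣ ≡ suc n) where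

    private
      total : symDist A B ℕ.+ 2 ℕ.* ∣ A ∩ B ∣ ≡ 2 ℕ.+ 2 ℕ.* n
      total = trans (symDist-∩ A B) (trans (cong₂ ℕ._+_ ∣A∣ ∣B∣) (double n))
        where
        double : ∀ n → suc n ℕ.+ suc n ≡ 2 ℕ.+ 2 ℕ.* n
        double = ℕ-Ring.solve-∀

    -- The distance is 2 n + 2 minus twice the size of the intersection, so disjoint sets lie just
    -- beyond the threshold 2 n.
    close⇒meet : symDist A B ℕ.≤ 2 ℕ.* n → ∃ λ a → a Subset.∈ A × a Subset.∈ B
    close⇒meet close with Subsetₚ.nonempty? (A ∩ B)
    ... | yes (a , a∈) = a , Subsetₚ.x∈p∩q⁻ A B a∈
    ... | no  empty    = contradiction close (ℕₚ.<⇒≱ (subst (2 ℕ.* n ℕ.<_)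
          (trans (sym total) (trans (cong (λ c → symDist A B ℕ.+ 2 ℕ.* c) ∣A∩B∣≡0) (ℕₚ.+-identityʳ _)))
          (ℕₚ.m<n+m (2 ℕ.* n) {2} (ℕ.s≤s ℕ.z≤n))))
      where
      ∣A∩B∣≡0 : ∣ A ∩ B ∣ ≡ 0
      ∣A∩B∣≡0 = trans (cong ∣_∣ (Subsetₚ.Empty-unique empty)) (Subsetₚ.∣⊥∣≡0 m)

    meet⇒close : ∀ {a} → a Subset.∈ A → a Subset.∈ B → symDist A B ℕ.≤ 2 ℕ.* n
    meet⇒close {a} a∈A a∈B = ℕₚ.+-cancelʳ-≤ 2 (symDist A B) (2 ℕ.* n)
      (ℕₚ.≤-trans (ℕₚ.+-monoʳ-≤ (symDist A B) (ℕₚ.*-monoʳ-≤ 2 nonempty))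
        (ℕₚ.≤-reflexive (trans total (ℕₚ.+-comm 2 (2 ℕ.* n)))))
      where
      nonempty : 1 ℕ.≤ ∣ A ∩ B ∣
      nonempty = subst (ℕ._≤ ∣ A ∩ B ∣) (Subsetₚ.∣⁅x⁆∣≡1 a)
        (Subsetₚ.p⊆q⇒∣p∣≤∣q∣ λ x∈ → subst (Subset._∈ A ∩ B) (sym (Subsetₚ.x∈⁅y⁆⇒x≡y a x∈)) (Subsetₚ.x∈p∩q⁺ (a∈A , a∈B)))

  -- The enumerations of Defs list every object exactly once

  lookup-injective : ∀ {A : Set} {xs : List A} → Unique xs → ∀ {i j} → lookup xs i ≡ lookup xs j → i ≡ j
  lookup-injective (x∉ ∷ u) {zero}  {zero}  e = refl
  lookup-injective (x∉ ∷ u) {zero}  {suc j} e = contradiction e (All.lookup x∉ (∈-lookup j))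
  lookup-injective (x∉ ∷ u) {suc i} {zero}  e = contradiction (sym e) (All.lookup x∉ (∈-lookup i))
  lookup-injective (x∉ ∷ u) {suc i} {suc j} e = cong suc (lookup-injective u e)

  ∈-subsets : ∀ {m} (A : Subset m) → A ∈ subsets m
  ∈-subsets []ᵥ                  = here refl
  ∈-subsets {suc m} (false ∷ᵥ A) = ∈-++⁺ˡ (∈-map⁺ _ (∈-subsets A))
  ∈-subsets {suc m} (true ∷ᵥ A)  = ∈-++⁺ʳ (map (false ∷ᵥ_) (subsets m)) (∈-map⁺ _ (∈-subsets A))

  -- Opens `allVecs` to the library's membership and uniqueness lemmas for Cartesian products.
  concatMap≡cartesianProductWith : ∀ {A B C : Set} (f : A → B → C) xs ys →
    concatMap (λ x → map (f x) ys) xs ≡ cartesianProductWith f xs ys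
  concatMap≡cartesianProductWith f []       ys = refl
  concatMap≡cartesianProductWith f (x ∷ xs) ys = cong (map (f x) ys ++_) (concatMap≡cartesianProductWith f xs ys)

  ∈-allVecs : ∀ {j N} (v : Vec (Fin N) j) → v ∈ allVecs j N
  ∈-allVecs []ᵥ = here refl
  ∈-allVecs {suc j} {N} (x ∷ᵥ v) = subst (x ∷ᵥ v ∈_)
    (sym (concatMap≡cartesianProductWith _∷ᵥ_ (allFin N) (allVecs j N)))
    (∈-cartesianProductWith⁺ _∷ᵥ_ (∈-allFin x) (∈-allVecs v))

  allVecs-unique : ∀ j N → Unique (allVecs j N)
  allVecs-unique zero    N = [] ∷ []
  allVecs-unique (suc j) N = subst Unique
    (sym (concatMap≡cartesianProductWith _∷ᵥ_ (allFin N) (allVecs j N)))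
    (cartesianProductWith⁺ _∷ᵥ_ ∷ᵥ-injective (allFin⁺ N) (allVecs-unique j N))

  toList-injective : ∀ {A : Set} {j} (v w : Vec A j) → toList v ≡ toList w → v ≡ w
  toList-injective []ᵥ      []ᵥ      e    = refl
  toList-injective (x ∷ᵥ v) (y ∷ᵥ w) e with toList v in eqv | toList w in eqw | e
  ... | _ | _ | refl = cong (x ∷ᵥ_) (toList-injective v w (trans eqv (sym eqw)))

  module _ {N : ℕ} where

    increasingᵇ⇒Asc : ∀ (x : Fin N) l → T (increasingᵇ (x ∷ l)) → Asc (x <_) (length l) l
    increasingᵇ⇒Asc x []      _ = tt
    increasingᵇ⇒Asc x (y ∷ l) p = x<y , asc-mono (length l) (λ z y<z → Finₚ.<-trans x<y y<z , y<z)
        (increasingᵇ⇒Asc y l (proj₂ q))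
      where
      q = Equivalence.to (T-∧ {toℕ x <ᵇ toℕ y}) p
      x<y = ℕₚ.<ᵇ⇒< (toℕ x) (toℕ y) (proj₁ q)

    increasingᵇ⇒Increasing : ∀ (l : List (Fin N)) → T (increasingᵇ l) → Increasing (length l) l
    increasingᵇ⇒Increasing []      _ = tt
    increasingᵇ⇒Increasing (x ∷ l) p = tt , asc-mono (length l) (λ _ → tt ,_) (increasingᵇ⇒Asc x l p)

    Increasing⇒increasingᵇ : ∀ j {l : List (Fin N)} → Increasing j l → T (increasingᵇ l)
    Increasing⇒increasingᵇ zero          {[]}        _ = tt
    Increasing⇒increasingᵇ (suc j)       {x ∷ []}    _ = tt
    Increasing⇒increasingᵇ (suc (suc j)) {x ∷ y ∷ l} (_ , p) = Equivalence.from T-∧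
      (ℕₚ.<⇒<ᵇ (proj₂ (proj₁ p)) , Increasing⇒increasingᵇ (suc j) (asc-mono (suc j) (λ _ _ → tt) p))

  Asc-length : ∀ {N} {C : Fin N → Set} j {l} → Asc C j l → length l ≡ j
  Asc-length zero    {[]}    _       = refl
  Asc-length (suc j) {x ∷ l} (_ , p) = cong suc (Asc-length j p)

  module _ {A : Set} where

    allᵇ⇒ : ∀ (p : A → Bool) l → T (allᵇ p l) → ∀ {y} → y ∈ l → T (p y)
    allᵇ⇒ p (x ∷ l) q (here refl) = proj₁ (Equivalence.to (T-∧ {p x}) q)
    allᵇ⇒ p (x ∷ l) q (there y∈l) = allᵇ⇒ p l (proj₂ (Equivalence.to (T-∧ {p x}) q)) y∈l

    ⇒allᵇ : ∀ (p : A → Bool) l → (∀ {y} → y ∈ l → T (p y)) → T (allᵇ p l)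
    ⇒allᵇ p []      q = tt
    ⇒allᵇ p (x ∷ l) q = Equivalence.from T-∧ (q (here refl) , ⇒allᵇ p l (q ∘ there))

    -- The test sees each pair of positions in one order only and never an entry against itself;
    -- symmetry and reflexivity supply the rest.
    pairwiseᵇ⇒ : ∀ (R : A → A → Bool) → (∀ x → T (R x x)) → (∀ x y → T (R x y) → T (R y x)) →
                 ∀ l → T (pairwiseᵇ R l) → ∀ {x y} → x ∈ l → y ∈ l → T (R x y)
    pairwiseᵇ⇒ R R-refl R-sym (z ∷ l) q = go
      where
      q′ = Equivalence.to (T-∧ {allᵇ (R z) l}) q
      go : ∀ {x y} → x ∈ z ∷ l → y ∈ z ∷ l → T (R x y)
      go (here refl) (here refl) = R-refl _
      go (here refl) (there y∈l) = allᵇ⇒ (R z) l (proj₁ q′) y∈l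
      go (there x∈l) (here refl) = R-sym z _ (allᵇ⇒ (R z) l (proj₁ q′) x∈l)
      go (there x∈l) (there y∈l) = pairwiseᵇ⇒ R R-refl R-sym l (proj₂ q′) x∈l y∈l

    ⇒pairwiseᵇ : ∀ (R : A → A → Bool) l → (∀ {x y} → x ∈ l → y ∈ l → T (R x y)) → T (pairwiseᵇ R l)
    ⇒pairwiseᵇ R []      q = tt
    ⇒pairwiseᵇ R (x ∷ l) q = Equivalence.from T-∧
      (⇒allᵇ (R x) l (λ y∈l → q (here refl) (there y∈l)) , ⇒pairwiseᵇ R l (λ x∈l y∈l → q (there x∈l) (there y∈l)))

  -- Writing n + 1 for the size of the sets makes the threshold 2 n.
  module _ (m n : ℕ) where

    private
      r = 2 ℕ.* n
      P = pt m (suc n)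

    Vertex : Set
    Vertex = Fin (NV m (suc n))

    Meet : Vertex → Vertex → Set
    Meet x y = ∃ λ a → a Subset.∈ P x × a Subset.∈ P y

    Simplex : ℕ → List Vertex → Set
    Simplex j u = Increasing j u × (∀ {x y} → x ∈ u → y ∈ u → Meet x y)

    pt-size : ∀ x → ∣ P x ∣ ≡ suc n
    pt-size x = ℕₚ.≡ᵇ⇒≡ ∣ P x ∣ (suc n)
      (proj₂ (∈-filter⁻ (λ A → T? (∣ A ∣ ≡ᵇ suc n)) {xs = subsets m} (∈-lookup x)))

    vertex : ∀ {A} → ∣ A ∣ ≡ suc n → ∃ λ x → P x ≡ A
    vertex {A} ∣A∣ = Any.index A∈ , sym (lookup-index A∈)
      where A∈ = ∈-filter⁺ (λ A → T? (∣ A ∣ ≡ᵇ suc n)) (∈-subsets A) (ℕₚ.≡⇒≡ᵇ ∣ A ∣ (suc n) ∣A∣)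

    closeᵇ : Vertex → Vertex → Bool
    closeᵇ x y = symDist (P x) (P y) ≤ᵇ r

    closeᵇ⇒Meet : ∀ x y → T (closeᵇ x y) → Meet x y
    closeᵇ⇒Meet x y p = close⇒meet (pt-size x) (pt-size y) (ℕₚ.≤ᵇ⇒≤ (symDist (P x) (P y)) r p)

    Meet⇒closeᵇ : ∀ x y → Meet x y → T (closeᵇ x y)
    Meet⇒closeᵇ x y (a , a∈x , a∈y) = ℕₚ.≤⇒≤ᵇ (meet⇒close (pt-size x) (pt-size y) a∈x a∈y)

    closeᵇ-refl : ∀ x → T (closeᵇ x x)
    closeᵇ-refl x = ℕₚ.≤⇒≤ᵇ (subst (ℕ._≤ r) (sym (symDist-self (P x))) ℕ.z≤n)
      where
      symDist-self : ∀ {m} (A : Subset m) → symDist A A ≡ 0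
      symDist-self []ᵥ          = refl
      symDist-self (false ∷ᵥ A) = symDist-self A
      symDist-self (true ∷ᵥ A)  = symDist-self A

    closeᵇ-sym : ∀ x y → T (closeᵇ x y) → T (closeᵇ y x)
    closeᵇ-sym x y p = let a , a∈x , a∈y = closeᵇ⇒Meet x y p in Meet⇒closeᵇ y x (a , a∈y , a∈x)

    vertices : ∀ j → Fin (NS m (suc n) r j) → List Vertex
    vertices j σ = toList (simp m (suc n) r j σ)

    Simp-∈⁻ : ∀ j {v} → v ∈ Simp m (suc n) r j → T (increasingᵇ (toList v) ∧ pairwiseᵇ closeᵇ (toList v))
    Simp-∈⁻ j v∈ = proj₂ (∈-filter⁻ (λ _ → T? _) {xs = allVecs j (NV m (suc n))} v∈)

    Simp-∈⁺ : ∀ j {v} → T (increasingᵇ (toList v) ∧ pairwiseᵇ closeᵇ (toList v)) → v ∈ Simp m (suc n) r j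
    Simp-∈⁺ j {v} p = ∈-filter⁺ (λ _ → T? _) (∈-allVecs v) p

    Simp-unique : ∀ j → Unique (Simp m (suc n) r j)
    Simp-unique j = filter⁺ (λ _ → T? _) (allVecs-unique j _)

    vertices-simplex : ∀ j (σ : Fin (NS m (suc n) r j)) → Simplex j (vertices j σ)
    vertices-simplex j σ =
      subst (λ k → Increasing k l) (length-toList (simp m (suc n) r j σ)) (increasingᵇ⇒Increasing l (proj₁ p)) ,
      λ x∈ y∈ → closeᵇ⇒Meet _ _ (pairwiseᵇ⇒ closeᵇ closeᵇ-refl closeᵇ-sym l (proj₂ p) x∈ y∈)
      where
      l = vertices j σ
      p = Equivalence.to (T-∧ {increasingᵇ l}) (Simp-∈⁻ j (∈-lookup σ))

    simplex-vertices : ∀ j {u} → Simplex j u → ∃ λ σ → vertices j σ ≡ u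
    simplex-vertices j {u} (p , q) with refl ← Asc-length j p =
      Any.index v∈ , trans (cong toList (sym (lookup-index v∈))) (toList∘fromList u)
      where
      v∈ : fromList u ∈ Simp m (suc n) r (length u)
      v∈ = Simp-∈⁺ (length u) (subst (λ l → T (increasingᵇ l ∧ pairwiseᵇ closeᵇ l)) (sym (toList∘fromList u))
        (Equivalence.from T-∧ (Increasing⇒increasingᵇ (length u) p , ⇒pairwiseᵇ closeᵇ u (λ x∈ y∈ → Meet⇒closeᵇ _ _ (q x∈ y∈)))))

    vertices-injective : ∀ j {σ τ : Fin (NS m (suc n) r j)} → vertices j σ ≡ vertices j τ → σ ≡ τ
    vertices-injective j e = lookup-injective (Simp-unique j) (toList-injective _ _ e)

  sign-suc : ∀ {k} (i : Fin k) → sign (suc i) ≡ - sign i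
  sign-suc i = parity (toℕ i)
    where
    parity : ∀ k → (if (suc k ℕ.% 2) ≡ᵇ 0 then 1ℚ else - 1ℚ) ≡ - (if (k ℕ.% 2) ≡ᵇ 0 then 1ℚ else - 1ℚ)
    parity zero          = refl
    parity (suc zero)    = refl
    parity (suc (suc k)) = parity k

  -- Splitting off the face without the first vertex shifts all other signs, which is the recursion
  -- of `δ`.
  alternating-δ : ∀ {N j} (φ : Cochain (Fin N)) (v : Vec (Fin N) (suc j)) →
                  ΣF (suc j) (λ i → sign i * φ (toList (removeAt v i))) ≡ δ φ (toList v)
  alternating-δ {j = zero}  φ (x ∷ᵥ []ᵥ) = solve 1 (λ a → con 1ℚ :* a :+ con 0ℚ := a :- con 0ℚ) refl (φ [])
  alternating-δ {j = suc j} φ (x ∷ᵥ v@(_ ∷ᵥ _)) = begin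
    1ℚ * φ (toList v) + ΣF (suc j) (λ i → sign (suc i) * φₓ (toList (removeAt v i)))
      ≡⟨ cong₂ _+_ (ℚₚ.*-identityˡ (φ (toList v))) (ΣF-cong (suc j) λ i →
           trans (cong (_* φₓ (toList (removeAt v i))) (sign-suc i)) (sym (ℚₚ.neg-distribˡ-* (sign i) (φₓ (toList (removeAt v i)))))) ⟩
    φ (toList v) + ΣF (suc j) (λ i → - (sign i * φₓ (toList (removeAt v i))))
      ≡⟨ cong (φ (toList v) +_) (trans (ΣF-neg (suc j) (λ i → sign i * φₓ (toList (removeAt v i)))) (cong -_ (alternating-δ φₓ v))) ⟩
    φ (toList v) - δ φₓ (toList v) ∎
    where φₓ = φ ∘ (x ∷_)

  -- The chain complex seen through functionals

  module Complex (n : ℕ) where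

    V : ℕ → Set
    V m = Vertex m n

    C : ℕ → ℕ → Set
    C m j = Chain m (suc n) (2 ℕ.* n) j

    # : ℕ → ℕ → ℕ
    # m j = NS m (suc n) (2 ℕ.* n) j

    d : ∀ m j → C m (suc j) → C m j
    d m j = ∂ m (suc n) (2 ℕ.* n) j

    Cycle Boundary : ∀ m q → C m (suc q) → Set
    Cycle    m q = IsCycle m (suc n) (2 ℕ.* n) q
    Boundary m q = IsBoundary m (suc n) (2 ℕ.* n) q

    module _ (m j : ℕ) where

      -- The pairing of chains with cochains. Indicators recover the coefficients, so identities of
      -- chains can be checked on functionals.
      eval : C m j → Functional (V m)
      eval c φ = ΣF (# m j) (λ σ → c σ * φ (vertices m n j σ))

      indicator : Fin (# m j) → Cochain (V m)
      indicator τ u = if ⌊ List-≡-dec Finₚ._≟_ u (vertices m n j τ) ⌋ then 1ℚ else 0ℚ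

      indicator-self : ∀ τ → indicator τ (vertices m n j τ) ≡ 1ℚ
      indicator-self τ with List-≡-dec Finₚ._≟_ (vertices m n j τ) (vertices m n j τ)
      ... | yes _ = refl
      ... | no ≢  = contradiction refl ≢

      indicator-other : ∀ {σ τ} → σ ≢ τ → indicator τ (vertices m n j σ) ≡ 0ℚ
      indicator-other {σ} {τ} σ≢τ with List-≡-dec Finₚ._≟_ (vertices m n j σ) (vertices m n j τ)
      ... | yes e = contradiction (vertices-injective m n j e) σ≢τ
      ... | no _  = refl

      eval-indicator : ∀ c τ → eval c (indicator τ) ≡ c τ
      eval-indicator c τ = begin
        eval c (indicator τ)
          ≡⟨ ΣF-single τ (λ σ τ≢σ → trans (cong (c σ *_) (indicator-other (τ≢σ ∘ sym))) (ℚₚ.*-zeroʳ (c σ))) ⟩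
        c τ * indicator τ (vertices m n j τ) ≡⟨ cong (c τ *_) (indicator-self τ) ⟩
        c τ * 1ℚ             ≡⟨ ℚₚ.*-identityʳ (c τ) ⟩
        c τ                  ∎

      -- The expansion that `eval-op` feeds to `LinearOn`.
      indicator-expand : ∀ φ u → Simplex m n j u → φ u ≡ lincomb _ (φ ∘ vertices m n j) indicator u
      indicator-expand φ u p with σ , refl ← simplex-vertices m n j p = sym (begin
        lincomb _ (φ ∘ vertices m n j) indicator (vertices m n j σ)
          ≡⟨ ΣF-single σ (λ τ σ≢τ → trans (cong (φ (vertices m n j τ) *_) (indicator-other σ≢τ)) (ℚₚ.*-zeroʳ (φ (vertices m n j τ)))) ⟩
        φ (vertices m n j σ) * indicator σ (vertices m n j σ)
          ≡⟨ cong (φ (vertices m n j σ) *_) (indicator-self σ) ⟩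
        φ (vertices m n j σ) * 1ℚ
          ≡⟨ ℚₚ.*-identityʳ (φ (vertices m n j σ)) ⟩
        φ (vertices m n j σ) ∎)

      eval-cong : ∀ c {φ ψ} → (∀ t → Simplex m n j t → φ t ≡ ψ t) → eval c φ ≡ eval c ψ
      eval-cong c e = ΣF-cong _ (λ σ → cong (c σ *_) (e _ (vertices-simplex m n j σ)))

      eval-subᶜ : ∀ c φ ψ → eval c (λ t → φ t - ψ t) ≡ eval c φ - eval c ψ
      eval-subᶜ c φ ψ = trans
        (ΣF-cong _ (λ σ → solve 3 (λ a b c → a :* (b :- c) := a :* b :- a :* c) refl (c σ) (φ (vertices m n j σ)) (ψ (vertices m n j σ))))
        (ΣF-sub (# m j) (λ σ → c σ * φ (vertices m n j σ)) (λ σ → c σ * ψ (vertices m n j σ)))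

      eval-zero : ∀ {c} → (∀ σ → c σ ≡ 0ℚ) → ∀ φ → eval c φ ≡ 0ℚ
      eval-zero e φ = ΣF-zero _ (λ σ → trans (cong (_* φ (vertices m n j σ)) (e σ)) (ℚₚ.*-zeroˡ (φ (vertices m n j σ))))

      eval-sub : ∀ c c′ φ → eval (λ σ → c σ - c′ σ) φ ≡ eval c φ - eval c′ φ
      eval-sub c c′ φ = trans
        (ΣF-cong _ (λ σ → solve 3 (λ a b c → (a :- b) :* c := a :* c :- b :* c) refl (c σ) (c′ σ) (φ (vertices m n j σ))))
        (ΣF-sub (# m j) (λ σ → c σ * φ (vertices m n j σ)) (λ σ → c′ σ * φ (vertices m n j σ)))

      eval-lincomb : ∀ k a (v : Fin k → C m j) φ → eval (lincomb k a v) φ ≡ ΣF k (λ i → a i * eval (v i) φ)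
      eval-lincomb k a v φ = begin
        ΣF _ (λ σ → ΣF k (λ i → a i * v i σ) * φ′ σ)   ≡⟨ ΣF-cong _ (λ σ → sym (ΣF-*ʳ k (φ′ σ) _)) ⟩
        ΣF _ (λ σ → ΣF k (λ i → a i * v i σ * φ′ σ))   ≡⟨ ΣF-swap (# m j) k (λ σ i → a i * v i σ * φ′ σ) ⟩
        ΣF k (λ i → ΣF _ (λ σ → a i * v i σ * φ′ σ))
          ≡⟨ ΣF-cong k (λ i → ΣF-cong _ (λ σ → ℚₚ.*-assoc (a i) (v i σ) (φ′ σ))) ⟩
        ΣF k (λ i → ΣF _ (λ σ → a i * (v i σ * φ′ σ))) ≡⟨ ΣF-cong k (λ i → ΣF-*ˡ (# m j) (a i) (λ σ → v i σ * φ′ σ)) ⟩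
        ΣF k (λ i → a i * eval (v i) φ)                ∎
        where φ′ = φ ∘ vertices m n j

    module _ (m j m′ j′ : ℕ) where

      op : (List (V m) → Functional (V m′)) → C m j → C m′ j′
      op Φ c τ = eval m j c (λ t → Φ t (indicator m′ j′ τ))

      -- `op Φ` is built from values of `Φ t` at indicators only; linearity supported on simplices
      -- extends the adjunction to every cochain.
      eval-op : ∀ {Φ} → (∀ t → Simplex m n j t → LinearOn (Simplex m′ n j′) (Φ t)) →
                ∀ c φ → eval m′ j′ (op Φ c) φ ≡ eval m j c (λ t → Φ t φ)
      eval-op {Φ} l c φ = begin
        ΣF _ (λ τ → ΣF _ (λ σ → c σ * Φσ σ τ) * φ′ τ)
          ≡⟨ ΣF-cong _ (λ τ → sym (ΣF-*ʳ (# m j) (φ′ τ) (λ σ → c σ * Φσ σ τ))) ⟩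
        ΣF _ (λ τ → ΣF _ (λ σ → c σ * Φσ σ τ * φ′ τ))  ≡⟨ ΣF-swap (# m′ j′) (# m j) (λ τ σ → c σ * Φσ σ τ * φ′ τ) ⟩
        ΣF _ (λ σ → ΣF _ (λ τ → c σ * Φσ σ τ * φ′ τ))
          ≡⟨ ΣF-cong _ (λ σ → ΣF-cong _ (λ τ →
               solve 3 (λ a b c → a :* b :* c := a :* (c :* b)) refl (c σ) (Φσ σ τ) (φ′ τ))) ⟩
        ΣF _ (λ σ → ΣF _ (λ τ → c σ * (φ′ τ * Φσ σ τ)))
          ≡⟨ ΣF-cong _ (λ σ → ΣF-*ˡ (# m′ j′) (c σ) (λ τ → φ′ τ * Φσ σ τ)) ⟩
        ΣF _ (λ σ → c σ * ΣF _ (λ τ → φ′ τ * Φσ σ τ))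
          ≡⟨ ΣF-cong _ (λ σ → cong (c σ *_) (sym
               (l _ (vertices-simplex m n j σ) _ φ′ (indicator m′ j′) φ (indicator-expand m′ j′ φ)))) ⟩
        ΣF _ (λ σ → c σ * Φ (vertices m n j σ) φ)       ∎
        where
        φ′ = φ ∘ vertices m′ n j′
        Φσ = λ σ τ → Φ (vertices m n j σ) (indicator m′ j′ τ)

    -- The incidence number of `τ` in `σ` is the value of the indicator of `τ` on the boundary of
    -- `σ`.
    ∂≡op-δ : ∀ m j c τ → d m j c τ ≡ op m (suc j) m j (λ t φ → δ φ t) c τ
    ∂≡op-δ m j c τ = ΣF-cong _ λ σ → trans (ℚₚ.*-comm (incidence m (suc n) (2 ℕ.* n) j τ σ) (c σ)) (cong (c σ *_) (begin
      incidence m (suc n) (2 ℕ.* n) j τ σ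
        ≡⟨ ΣF-cong (suc j) (λ i → term (removeAt (simp m (suc n) (2 ℕ.* n) (suc j) σ) i) (sign i)) ⟩
      ΣF (suc j) (λ i → sign i * indicator m j τ (toList (removeAt (simp m (suc n) (2 ℕ.* n) (suc j) σ) i)))
        ≡⟨ alternating-δ (indicator m j τ) (simp m (suc n) (2 ℕ.* n) (suc j) σ) ⟩
      δ (indicator m j τ) (vertices m n (suc j) σ) ∎))
      where
      term : ∀ v s → (if ⌊ Vec-≡-dec Finₚ._≟_ v (simp m (suc n) (2 ℕ.* n) j τ) ⌋ then s else 0ℚ) ≡
                     s * indicator m j τ (toList v)
      term v s with Vec-≡-dec Finₚ._≟_ v (simp m (suc n) (2 ℕ.* n) j τ) | List-≡-dec Finₚ._≟_ (toList v) (vertices m n j τ)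
      ... | yes _ | yes _ = sym (ℚₚ.*-identityʳ s)
      ... | no _  | no _  = sym (ℚₚ.*-zeroʳ s)
      ... | yes e | no ≢  = contradiction (cong toList e) ≢
      ... | no ≢  | yes e = contradiction (toList-injective _ _ e) ≢

    -- Stokes' formula. It applies `eval-op`, as faces of a clique are cliques.
    eval-∂ : ∀ m j c φ → eval m j (d m j c) φ ≡ eval m (suc j) c (δ φ)
    eval-∂ m j c φ = trans
      (ΣF-cong _ (λ τ → cong (_* φ (vertices m n j τ)) (∂≡op-δ m j c τ)))
      (eval-op m (suc j) m j (λ t p → lin-mono (face p) (δ-lin (suc j) (asc-restrict (suc j) id (proj₁ p)))) c φ)
      where
      face : ∀ {t} → Simplex m n (suc j) t → ∀ u → Asc (_∈ t) j u → Simplex m n j u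
      face (_ , clique) u u↑ = asc-mono j (λ _ _ → tt) u↑ , λ x∈u y∈u → clique (asc-all j u↑ x∈u) (asc-all j u↑ y∈u)

    boundary-cong : ∀ m q {x y} → (∀ τ → x τ ≡ y τ) → Boundary m q y → Boundary m q x
    boundary-cong m q e (w , p) = w , λ τ → trans (e τ) (p τ)

    boundary-sub : ∀ m q {x y} → Boundary m q x → Boundary m q y → Boundary m q (λ τ → x τ - y τ)
    boundary-sub m q {x} {y} (w , p) (w′ , p′) = (λ σ → w σ - w′ σ) , λ τ → begin
      x τ - y τ
        ≡⟨ cong₂ _-_ (trans (p τ) (∂≡op-δ m (suc q) w τ)) (trans (p′ τ) (∂≡op-δ m (suc q) w′ τ)) ⟩
      eval m (2 ℕ.+ q) w (δ _) - eval m (2 ℕ.+ q) w′ (δ _)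
        ≡⟨ sym (eval-sub m (2 ℕ.+ q) w w′ (δ (indicator m (suc q) τ))) ⟩
      eval m (2 ℕ.+ q) (λ σ → w σ - w′ σ) (δ _)           ≡⟨ sym (∂≡op-δ m (suc q) _ τ) ⟩
      d m (suc q) (λ σ → w σ - w′ σ) τ                    ∎

    boundary-lincomb : ∀ m q k a {v : Fin k → C m (suc q)} → (∀ i → Boundary m q (v i)) → Boundary m q (lincomb k a v)
    boundary-lincomb m q k a {v} b = lincomb k a (proj₁ ∘ b) , λ τ → begin
      ΣF k (λ i → a i * v i τ)
        ≡⟨ ΣF-cong k (λ i → cong (a i *_) (trans (proj₂ (b i) τ) (∂≡op-δ m (suc q) _ τ))) ⟩
      ΣF k (λ i → a i * eval m (2 ℕ.+ q) (proj₁ (b i)) (δ _))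
        ≡⟨ sym (eval-lincomb m (2 ℕ.+ q) k a (proj₁ ∘ b) (δ (indicator m (suc q) τ))) ⟩
      eval m (2 ℕ.+ q) (lincomb k a (proj₁ ∘ b)) (δ _)  ≡⟨ sym (∂≡op-δ m (suc q) _ τ) ⟩
      d m (suc q) (lincomb k a (proj₁ ∘ b)) τ           ∎

    -- Functoriality

    -- The choice of enlargement stays open: every set containing the image qualifies, so all
    -- choices share one carrier.
    Carries : ∀ {m m′} → (Fin m → Fin m′) → V m → V m′ → Set
    Carries {m} {m′} φ x y = ∀ a → a Subset.∈ pt m (suc n) x → φ a Subset.∈ pt m′ (suc n) y

    -- If two source sets share `a`, then all enlargements of their images share `φ a`. This is the
    -- contiguity of different choices.
    carrier-simplex : ∀ {m m′ j t} {φ : Fin m → Fin m′} → Simplex m n j t →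
                      ∀ j′ u → Asc (Carrier (Carries φ) t) j′ u → Simplex m′ n j′ u
    carrier-simplex {φ = φ} (_ , clique) j′ u u↑ = asc-mono j′ (λ _ _ → tt) u↑ , λ y∈u y′∈u →
      let x  , x∈t  , k  = asc-all j′ u↑ y∈u
          x′ , x′∈t , k′ = asc-all j′ u↑ y′∈u
          a , a∈x , a∈x′ = clique x∈t x′∈t
      in φ a , k a a∈x , k′ a a∈x′

    module _ {m m′ : ℕ} {φ : Fin m → Fin m′} (F : ChainMap (Carries φ)) where

      at-lin : ∀ j t → Simplex m n j t → LinearOn (Simplex m′ n j) (at F t)
      at-lin j t p = lin-mono (carrier-simplex {φ = φ} p j) (carried F j (proj₁ p))

      _⁎ : ∀ j → C m j → C m′ j
      _⁎ j = op m j m′ j (at F)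

      ⁎-∂ : ∀ j c τ → d m′ j (_⁎ (suc j) c) τ ≡ _⁎ j (d m j c) τ
      ⁎-∂ j c τ = begin
        d m′ j (_⁎ (suc j) c) τ
          ≡⟨ ∂≡op-δ m′ j _ τ ⟩
        eval m′ (suc j) (_⁎ (suc j) c) (δ ind)
          ≡⟨ eval-op m (suc j) m′ (suc j) (at-lin (suc j)) c (δ ind) ⟩
        eval m (suc j) c (λ t → at F t (δ ind))
          ≡⟨ eval-cong m (suc j) c (λ t p → at-δ F ind (proj₁ p)) ⟩
        eval m (suc j) c (δ (λ s → at F s ind))
          ≡⟨ sym (eval-∂ m j c (λ s → at F s ind)) ⟩
        _⁎ j (d m j c) τ ∎
        where ind = indicator m′ j τ

      ⁎-cycle : ∀ q {z} → Cycle m q z → Cycle m′ q (_⁎ (suc q) z)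
      ⁎-cycle q {z} zc τ = trans (⁎-∂ q z τ) (eval-zero m q zc (λ t → at F t (indicator m′ q τ)))

      ⁎-boundary : ∀ q {x} → Boundary m q x → Boundary m′ q (_⁎ (suc q) x)
      ⁎-boundary q {x} (w , p) = _⁎ (2 ℕ.+ q) w , λ τ →
        trans (ΣF-cong _ (λ σ → cong (_* at F (vertices m n (suc q) σ) (indicator m′ (suc q) τ)) (p σ)))
              (sym (⁎-∂ (suc q) w τ))

    module _ {m m′ m″ : ℕ} {φ : Fin m → Fin m′} {ψ : Fin m′ → Fin m″} {χ : Fin m → Fin m″} (e : ∀ a → ψ (φ a) ≡ χ a)
             (F : ChainMap (Carries φ)) (G : ChainMap (Carries ψ)) where

      -- Labelling by any `χ` that agrees pointwise lets routes through different ground sets have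
      -- the same carrier, so that `homotopic` can compare them.
      composite : ChainMap (Carries χ)
      composite = compose (λ {x} {y} {z} k k′ a a∈x → subst (Subset._∈ pt m″ (suc n) z) (e a) (k′ (φ a) (k a a∈x))) F G

      ⁎-composite : ∀ j c τ → (G ⁎) j ((F ⁎) j c) τ ≡ (composite ⁎) j c τ
      ⁎-composite j c τ = eval-op m j m′ j (at-lin F j) c (λ u → at G u (indicator m″ j τ))

    -- On a cycle the identity ∂ h = G - F - h ∂ loses its last term. The vertices from `carry` are
    -- the apices of the cones.
    homotopic : ∀ {m m′} {φ : Fin m → Fin m′} → (∀ x → ∃ (Carries φ x)) → (F G : ChainMap (Carries φ)) →
                ∀ q {z} → Cycle m q z → Boundary m′ q (λ τ → _⁎ G (suc q) z τ - _⁎ F (suc q) z τ)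
    homotopic {m} {m′} {φ} carry F G q {z} zc = op m (suc q) m′ (2 ℕ.+ q) (homotopy (suc q)) z , λ τ →
      let ind = indicator m′ (suc q) τ in sym (begin
      d m′ (suc q) (op m (suc q) m′ (2 ℕ.+ q) (homotopy (suc q)) z) τ
        ≡⟨ ∂≡op-δ m′ (suc q) _ τ ⟩
      eval m′ (2 ℕ.+ q) (op m (suc q) m′ (2 ℕ.+ q) (homotopy (suc q)) z) (δ ind)
        ≡⟨ eval-op m (suc q) m′ (2 ℕ.+ q) (λ t p → lin-mono (carrier-simplex {φ = φ} p (2 ℕ.+ q)) (homotopy-lin (suc q) (proj₁ p))) z (δ ind) ⟩
      eval m (suc q) z (λ t → homotopy (suc q) t (δ ind))
        ≡⟨ eval-cong m (suc q) z (λ t p → homotopy-δ (suc q) ind (proj₁ p)) ⟩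
      eval m (suc q) z (λ t → at G t ind - at F t ind - δ (λ s → homotopy q s ind) t)
        ≡⟨ trans (eval-subᶜ m (suc q) z (λ t → at G t ind - at F t ind) (δ (λ s → homotopy q s ind)))
             (cong (_- eval m (suc q) z (δ (λ s → homotopy q s ind))) (eval-subᶜ m (suc q) z (λ t → at G t ind) (λ t → at F t ind))) ⟩
      _⁎ G (suc q) z τ - _⁎ F (suc q) z τ - eval m (suc q) z (δ (λ s → homotopy q s ind))
        ≡⟨ cong (λ e → _⁎ G (suc q) z τ - _⁎ F (suc q) z τ - e) (trans (sym (eval-∂ m q z (λ s → homotopy q s ind))) (eval-zero m q zc (λ s → homotopy q s ind))) ⟩
      _⁎ G (suc q) z τ - _⁎ F (suc q) z τ - 0ℚ
        ≡⟨ ℚₚ.+-identityʳ _ ⟩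
      _⁎ G (suc q) z τ - _⁎ F (suc q) z τ ∎)
      where open Homotopy (proj₂ ∘ carry) F G

  -- Images of sets and their enlargement

  ∣p∪q∣≤∣p∣+∣q∣ : ∀ {m} (p q : Subset m) → ∣ p ∪ q ∣ ℕ.≤ ∣ p ∣ ℕ.+ ∣ q ∣
  ∣p∪q∣≤∣p∣+∣q∣ []ᵥ          []ᵥ          = z≤n
  ∣p∪q∣≤∣p∣+∣q∣ (false ∷ᵥ p) (false ∷ᵥ q) = ∣p∪q∣≤∣p∣+∣q∣ p q
  ∣p∪q∣≤∣p∣+∣q∣ (false ∷ᵥ p) (true ∷ᵥ q)  =
    ℕₚ.≤-trans (s≤s (∣p∪q∣≤∣p∣+∣q∣ p q)) (ℕₚ.≤-reflexive (sym (ℕₚ.+-suc ∣ p ∣ ∣ q ∣)))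
  ∣p∪q∣≤∣p∣+∣q∣ (true ∷ᵥ p)  (false ∷ᵥ q) = s≤s (∣p∪q∣≤∣p∣+∣q∣ p q)
  ∣p∪q∣≤∣p∣+∣q∣ (true ∷ᵥ p)  (true ∷ᵥ q)  =
    s≤s (ℕₚ.≤-trans (∣p∪q∣≤∣p∣+∣q∣ p q) (ℕₚ.+-monoʳ-≤ ∣ p ∣ (ℕₚ.n≤1+n ∣ q ∣)))

  image : ∀ {m m′} → (Fin m → Fin m′) → Subset m → Subset m′
  image φ []ᵥ          = Subset.⊥
  image φ (false ∷ᵥ A) = image (φ ∘ suc) A
  image φ (true ∷ᵥ A)  = ⁅ φ zero ⁆ ∪ image (φ ∘ suc) A

  ∈-image : ∀ {m m′} (φ : Fin m → Fin m′) A {a} → a Subset.∈ A → φ a Subset.∈ image φ A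
  ∈-image φ (true ∷ᵥ A)  here       = Subsetₚ.x∈p∪q⁺ (inj₁ (Subsetₚ.x∈⁅x⁆ (φ zero)))
  ∈-image φ (true ∷ᵥ A)  (there a∈) = Subsetₚ.x∈p∪q⁺ (inj₂ (∈-image (φ ∘ suc) A a∈))
  ∈-image φ (false ∷ᵥ A) (there a∈) = ∈-image (φ ∘ suc) A a∈

  ∣image∣≤ : ∀ {m m′} (φ : Fin m → Fin m′) A → ∣ image φ A ∣ ℕ.≤ ∣ A ∣
  ∣image∣≤ {m′ = m′} φ []ᵥ = ℕₚ.≤-reflexive (Subsetₚ.∣⊥∣≡0 m′)
  ∣image∣≤ φ (false ∷ᵥ A)  = ∣image∣≤ (φ ∘ suc) A
  ∣image∣≤ φ (true ∷ᵥ A)   = ℕₚ.≤-trans (∣p∪q∣≤∣p∣+∣q∣ ⁅ φ zero ⁆ (image (φ ∘ suc) A))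
    (ℕₚ.+-mono-≤ (ℕₚ.≤-reflexive (Subsetₚ.∣⁅x⁆∣≡1 (φ zero))) (∣image∣≤ (φ ∘ suc) A))

  enlarge : ∀ {m k} (A : Subset m) → ∣ A ∣ ℕ.≤ k → k ℕ.≤ m → ∃ λ B → A Subset.⊆ B × ∣ B ∣ ≡ k
  enlarge []ᵥ          ∣A∣≤k z≤n = []ᵥ , (λ ()) , refl
  enlarge (true ∷ᵥ A)  (s≤s ∣A∣≤k) (s≤s k≤m) =
    let B , A⊆B , ∣B∣ = enlarge A ∣A∣≤k k≤m in
    true ∷ᵥ B , (λ { here → here ; (there a∈) → there (A⊆B a∈) }) , cong suc ∣B∣
  -- The absent first element is added only if all of `suc m` is asked for; otherwise `k` elements
  -- fit into the tail.
  enlarge {suc m} {k} (false ∷ᵥ A) ∣A∣≤k k≤1+m with k ℕₚ.≟ suc m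
  ... | yes refl = Subset.⊤ , (λ _ → Subsetₚ.∈⊤) , Subsetₚ.∣⊤∣≡n (suc m)
  ... | no  k≢   =
    let B , A⊆B , ∣B∣ = enlarge A ∣A∣≤k (ℕₚ.≤-pred (ℕₚ.≤∧≢⇒< k≤1+m k≢)) in
    false ∷ᵥ B , (λ { (there a∈) → there (A⊆B a∈) }) , ∣B∣

  -- Maps between the ground sets

  -- Only nonzero elements are skipped. Since `collapse i` identifies `suc i` with `zero`, its
  -- composite with the map skipping `zero` would be a bijection; this is why the factor is ℓ and
  -- not ℓ + 1.
  skip : ∀ {k} → Fin k → Fin k → Fin (suc k)
  skip i = punchIn (suc i)

  collapse : ∀ {k} → Fin (suc k) → Fin (suc (suc k)) → Fin (suc k)
  collapse i y with suc i Finₚ.≟ y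
  ... | yes _  = zero
  ... | no i≢y = punchOut i≢y

  collapse-skip : ∀ {k} (i a : Fin (suc k)) → collapse i (skip i a) ≡ a
  collapse-skip i a with suc i Finₚ.≟ punchIn (suc i) a
  ... | yes e  = contradiction (sym e) (Finₚ.punchInᵢ≢i (suc i) a)
  ... | no i≢  = trans (Finₚ.punchOut-cong (suc i) {i≢j = i≢} refl) (Finₚ.punchOut-punchIn (suc i) {a})

  -- `skip j` avoids `suc j`, and `collapse i` identifies nothing else with it, as it merges only
  -- `suc i` and `zero`.
  collapse-skip-misses : ∀ {k} (i j : Fin (suc k)) → i ≢ j → ∀ a → collapse i (suc j) ≢ collapse i (skip j a)
  collapse-skip-misses i j i≢j a with suc i Finₚ.≟ suc j | suc i Finₚ.≟ skip j a
  ... | yes e  | _      = contradiction (Finₚ.suc-injective e) i≢j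
  ... | no i≢j | no i≢a = λ e → Finₚ.punchInᵢ≢i (suc j) a (sym (Finₚ.punchOut-injective i≢j i≢a e))
  -- Here `skip j a` is the collapsed element and goes to `zero`, while `suc j` stays positive.
  -- Splitting on `k` lets `punchOut` compute; for `k = 0` there are no distinct `i` and `j`.
  collapse-skip-misses {suc k} i j i≢j a | no i≢j′ | yes _ = λ ()
  collapse-skip-misses {zero} zero zero i≢j a | no i≢j′ | yes _ = λ _ → i≢j refl

  -- Induced maps on homology and the rank bound

  module Intersecting (n : ℕ) where

    open Complex n

    carry : ∀ {m m′} → suc n ℕ.≤ m′ → (φ : Fin m → Fin m′) → ∀ x → ∃ (Carries φ x)
    carry {m} {m′} n<m′ φ x =
      let A = pt m (suc n) x
          B , A⊆B , ∣B∣ = enlarge (image φ A) (ℕₚ.≤-trans (∣image∣≤ φ A) (ℕₚ.≤-reflexive (pt-size m n x))) n<m′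
          y , y≡B = vertex m′ n ∣B∣
      in y , λ a a∈ → subst (φ a Subset.∈_) (sym y≡B) (A⊆B (∈-image φ A a∈))

    induced : ∀ {m m′} → suc n ℕ.≤ m′ → (φ : Fin m → Fin m′) → ChainMap (Carries φ)
    induced n<m′ φ = pushforward (proj₂ ∘ carry n<m′ φ)

    acyclic-bounds : ∀ m q → KRank (suc n) m q 0 → ∀ {z} → Cycle m q z → Boundary m q z
    acyclic-bounds m q (_ , _ , _ , spans) {z} zc =
      let _ , y , e = spans z zc in y , λ τ → trans (e τ) (ℚₚ.+-identityˡ (d m (suc q) y τ))

    module _ {m : ℕ} (v : V m) (meet : ∀ x y → Meet m n x y) (q : ℕ) where

      private
        wedge-support : ∀ j t → Simplex m n j t → LinearOn (Simplex m n (suc j)) (wedge v t)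
        wedge-support j t (t↑ , _) = lin-mono (λ u u↑ → u↑ , λ {x} {y} _ _ → meet x y) (wedge-lin j tt t↑)

        cone : C m (suc q) → C m (2 ℕ.+ q)
        cone = op m (suc q) m (2 ℕ.+ q) (wedge v)

        ∂-cone : ∀ z → Cycle m q z → ∀ τ → d m (suc q) (cone z) τ ≡ z τ
        ∂-cone z zc τ = begin
          d m (suc q) (cone z) τ
            ≡⟨ ∂≡op-δ m (suc q) (cone z) τ ⟩
          eval m (2 ℕ.+ q) (cone z) (δ ind)
            ≡⟨ eval-op m (suc q) m (2 ℕ.+ q) (wedge-support (suc q)) z (δ ind) ⟩
          eval m (suc q) z (λ t → wedge v t (δ ind))
            ≡⟨ eval-cong m (suc q) z (λ t p → wedge-δ v ind (proj₁ p)) ⟩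
          eval m (suc q) z (λ t → ind t - δ (λ w → wedge v w ind) t)
            ≡⟨ eval-subᶜ m (suc q) z ind (δ (λ w → wedge v w ind)) ⟩
          eval m (suc q) z ind - eval m (suc q) z (δ (λ w → wedge v w ind))
            ≡⟨ cong₂ _-_ (eval-indicator m (suc q) z τ)
                 (trans (sym (eval-∂ m q z (λ w → wedge v w ind))) (eval-zero m q zc (λ w → wedge v w ind))) ⟩
          z τ - 0ℚ
            ≡⟨ ℚₚ.+-identityʳ (z τ) ⟩
          z τ ∎
          where ind = indicator m (suc q) τ

      -- When any two sets meet the complex is a full simplex, and the exterior product with `v`
      -- contracts it.
      cone-acyclic : KRank (suc n) m q 0
      cone-acyclic = (λ ()) , (λ ()) , (λ _ _ ()) , λ z zc →
        (λ ()) , cone z , λ τ → sym (trans (ℚₚ.+-identityˡ (d m (suc q) (cone z) τ)) (∂-cone z zc τ))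

    full-acyclic : ∀ {m} → m ≡ suc n → ∀ q → KRank (suc n) m q 0
    full-acyclic {m} m≡1+n q = cone-acyclic {m} (proj₁ (vertex m n {Subset.⊤} (trans (Subsetₚ.∣⊤∣≡n m) m≡1+n)))
        (λ x y → a , ∈-pt x , ∈-pt y) q
      where
      a : Fin m
      a = subst Fin (sym m≡1+n) zero

      ∈-pt : ∀ x → a Subset.∈ pt m (suc n) x
      ∈-pt x = subst (a Subset.∈_) (sym (Subsetₚ.∣p∣≡n⇒p≡⊤ (trans (pt-size m n x) (sym m≡1+n)))) Subsetₚ.∈⊤

    module _ {m m′ : ℕ} (n<m : suc n ℕ.≤ m) (n<m′ : suc n ℕ.≤ m′)
             (ι : Fin m → Fin m′) (ρ : Fin m′ → Fin m) (q : ℕ) where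

      ρ∘ι : C m (suc q) → C m (suc q)
      ρ∘ι z = (induced n<m ρ ⁎) (suc q) ((induced n<m′ ι ⁎) (suc q) z)

      private
        ρι : ChainMap (Carries (ρ ∘ ι))
        ρι = composite (λ _ → refl) (induced n<m′ ι) (induced n<m ρ)

        ρ∘ι≡ : ∀ z τ → ρ∘ι z τ ≡ (ρι ⁎) (suc q) z τ
        ρ∘ι≡ = ⁎-composite (λ _ → refl) (induced n<m′ ι) (induced n<m ρ) (suc q)

      -- The identity chain map is carried by `ρ ∘ ι` too, so acyclic carriers compare it with the
      -- composite without computing any enlargement.
      retraction : (∀ a → ρ (ι a) ≡ a) → ∀ {z} → Cycle m q z → Boundary m q (λ τ → ρ∘ι z τ - z τ)
      retraction e {z} zc = boundary-cong m q
        (λ τ → cong₂ _-_ (ρ∘ι≡ z τ) (sym (eval-indicator m (suc q) z τ)))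
        (homotopic {φ = ρ ∘ ι} (carry n<m (ρ ∘ ι)) (identity λ x a a∈ → subst (Subset._∈ pt m (suc n) x) (sym (e a)) a∈) ρι q {z} zc)

      -- Along `α` the cycle already becomes a boundary, hence also along `β ∘ α`; the route through
      -- `ι` and `ρ` has the same carrier and differs by a boundary.
      null : ∀ {m₀} → suc n ℕ.≤ m₀ → KRank (suc n) m₀ q 0 →
             (α : Fin m → Fin m₀) (β : Fin m₀ → Fin m) → (∀ a → β (α a) ≡ ρ (ι a)) →
             ∀ {z} → Cycle m q z → Boundary m q (ρ∘ι z)
      null {m₀} n<m₀ acyclic α β e {z} zc = boundary-cong m q {ρ∘ι z} {λ τ → βα⁎z τ - (βα⁎z τ - ρι⁎z τ)}
          (λ τ → trans (ρ∘ι≡ z τ) (solve 2 (λ a b → a := b :- (b :- a)) refl (ρι⁎z τ) (βα⁎z τ)))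
          (boundary-sub m q {βα⁎z} {λ τ → βα⁎z τ - ρι⁎z τ}
            (boundary-cong m q {βα⁎z} {(induced n<m β ⁎) (suc q) α⁎z}
              (λ τ → sym (⁎-composite e (induced n<m₀ α) (induced n<m β) (suc q) z τ))
              (⁎-boundary (induced n<m β) q {α⁎z} (acyclic-bounds m₀ q acyclic (⁎-cycle (induced n<m₀ α) q {z} zc))))
            (homotopic {φ = ρ ∘ ι} (carry n<m (ρ ∘ ι)) ρι βα q {z} zc))
        where
        βα : ChainMap (Carries (ρ ∘ ι))
        βα = composite e (induced n<m₀ α) (induced n<m β)

        α⁎z : C m₀ (suc q)
        α⁎z = (induced n<m₀ α ⁎) (suc q) z
        βα⁎z ρι⁎z : C m (suc q)
        βα⁎z = (βα ⁎) (suc q) z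
        ρι⁎z = (ρι ⁎) (suc q) z

    -- If the composites ρ i ∘ ι j form an identity matrix up to maps factoring through m₀,
    -- so do the induced maps on homology, where m₀ contributes 0.
    module _ {m₀ L L′ : ℕ} (n<m₀ : suc n ℕ.≤ m₀) (n<L : suc n ℕ.≤ L) (n<L′ : suc n ℕ.≤ L′)
             {l : ℕ} (ι : Fin l → Fin L → Fin L′) (ρ : Fin l → Fin L′ → Fin L)
             (ρι-diagonal : ∀ i x → ρ i (ι i x) ≡ x)
             (ρι-off-diagonal : ∀ i j → i ≢ j → ∃ λ (α : Fin L → Fin m₀) → ∃ λ (β : Fin m₀ → Fin L) →
                                ∀ x → β (α x) ≡ ρ i (ι j x))
             (q : ℕ) (acyclic : KRank (suc n) m₀ q 0) where

      module _ {a b : ℕ} (v : Fin a → C L (suc q)) (v-cycle : ∀ j → Cycle L q (v j))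
               (v-independent : ∀ c → Boundary L q (lincomb a c v) → ∀ j → c j ≡ 0ℚ)
               (w : Fin b → C L′ (suc q))
               (w-spans : ∀ z → Cycle L′ q z → Σ (Fin b → ℚ) λ c → Σ (C L′ (2 ℕ.+ q)) λ y →
                          ∀ τ → z τ ≡ lincomb b c w τ + d L′ (suc q) y τ)
               (b<la : b ℕ.< l ℕ.* a) where

        private
          K = l ℕ.* a

          _₁ : Fin K → Fin l
          x ₁ = proj₁ (Fin.remQuot {l} a x)
          _₂ : Fin K → Fin a
          x ₂ = proj₂ (Fin.remQuot {l} a x)

          u : Fin K → C L′ (suc q)
          u x = (induced n<L′ (ι (x ₁)) ⁎) (suc q) (v (x ₂))

          u-spans : ∀ x → Σ (Fin b → ℚ) λ c → Σ (C L′ (2 ℕ.+ q)) λ y → ∀ τ → u x τ ≡ lincomb b c w τ + d L′ (suc q) y τ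
          u-spans x = w-spans (u x) (⁎-cycle (induced n<L′ (ι (x ₁))) q {v (x ₂)} (v-cycle (x ₂)))

          M : Fin K → Fin b → ℚ
          M x = proj₁ (u-spans x)

          -- The classes `u x` have `b` coordinates each in terms of `w`, and there are more than
          -- `b` of them.
          relation = dependent b<la M
          c  = proj₁ relation
          i₀ = proj₁ (proj₁ (proj₂ relation))
          c≢0 = proj₂ (proj₁ (proj₂ relation))

          -- Each `u x` minus its `w` part bounds, and the relation cancels the `w` parts.
          U-boundary : Boundary L′ q (lincomb K c u)
          U-boundary = boundary-cong L′ q {lincomb K c u} {lincomb K c (λ x τ → u x τ - lincomb b (M x) w τ)} vanish
            (boundary-lincomb L′ q K c {λ x τ → u x τ - lincomb b (M x) w τ}
              (λ x → proj₁ (proj₂ (u-spans x)) , λ τ →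
                trans (cong (_- lincomb b (M x) w τ) (proj₂ (proj₂ (u-spans x)) τ))
                  (solve 2 (λ s t → s :+ t :- s := t) refl (lincomb b (M x) w τ) (d L′ (suc q) (proj₁ (proj₂ (u-spans x))) τ))))
            where
            vanish : ∀ τ → lincomb K c u τ ≡ lincomb K c (λ x τ → u x τ - lincomb b (M x) w τ) τ
            vanish τ = begin
              ΣF K (λ x → c x * u x τ)
                ≡⟨ sym (ℚₚ.+-identityʳ (ΣF K (λ x → c x * u x τ))) ⟩
              ΣF K (λ x → c x * u x τ) - 0ℚ
                ≡⟨ cong (λ e → ΣF K (λ x → c x * u x τ) - e) (sym combination≡0) ⟩
              ΣF K (λ x → c x * u x τ) - ΣF K (λ x → c x * lincomb b (M x) w τ)
                ≡⟨ sym (ΣF-sub K (λ x → c x * u x τ) (λ x → c x * lincomb b (M x) w τ)) ⟩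
              ΣF K (λ x → c x * u x τ - c x * lincomb b (M x) w τ)
                ≡⟨ ΣF-cong K (λ x → solve 3 (λ a b c → a :* b :- a :* c := a :* (b :- c)) refl (c x) (u x τ) (lincomb b (M x) w τ)) ⟩
              ΣF K (λ x → c x * (u x τ - lincomb b (M x) w τ)) ∎
              where
              combination≡0 : ΣF K (λ x → c x * lincomb b (M x) w τ) ≡ 0ℚ
              combination≡0 = begin
                ΣF K (λ x → c x * ΣF b (λ k → M x k * w k τ))
                  ≡⟨ ΣF-cong K (λ x → sym (ΣF-*ˡ b (c x) (λ k → M x k * w k τ))) ⟩
                ΣF K (λ x → ΣF b (λ k → c x * (M x k * w k τ))) ≡⟨ ΣF-swap K b (λ x k → c x * (M x k * w k τ)) ⟩
                ΣF b (λ k → ΣF K (λ x → c x * (M x k * w k τ)))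
                  ≡⟨ ΣF-cong b (λ k → ΣF-cong K (λ x → sym (ℚₚ.*-assoc (c x) (M x k) (w k τ)))) ⟩
                ΣF b (λ k → ΣF K (λ x → c x * M x k * w k τ))
                  ≡⟨ ΣF-cong b (λ k → ΣF-*ʳ K (w k τ) (λ x → c x * M x k)) ⟩
                ΣF b (λ k → ΣF K (λ x → c x * M x k) * w k τ)
                  ≡⟨ ΣF-zero b (λ k → trans (cong (_* w k τ) (proj₂ (proj₂ relation) k)) (ℚₚ.*-zeroˡ (w k τ))) ⟩
                0ℚ                                              ∎

          module _ (i : Fin l) where

            ρ⁎ : C L′ (suc q) → C L (suc q)
            ρ⁎ = (induced n<L (ρ i) ⁎) (suc q)

            -- The Kronecker pattern that ρᵢ applied to the classes `u` follows modulo boundaries.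
            target : Fin l → Fin a → C L (suc q)
            target i′ j τ with i Finₚ.≟ i′
            ... | yes _ = v j τ
            ... | no  _ = 0ℚ

            ρu-target : ∀ i′ j → Boundary L q (λ τ → ρ⁎ ((induced n<L′ (ι i′) ⁎) (suc q) (v j)) τ - target i′ j τ)
            ρu-target i′ j with i Finₚ.≟ i′
            ... | yes refl = retraction n<L n<L′ (ι i) (ρ i) q (ρι-diagonal i) {v j} (v-cycle j)
            ... | no i≢i′  = let α , β , e = ρι-off-diagonal i i′ i≢i′ in
              boundary-cong L q {y = ρ⁎ ((induced n<L′ (ι i′) ⁎) (suc q) (v j))} (λ τ → ℚₚ.+-identityʳ (ρ⁎ ((induced n<L′ (ι i′) ⁎) (suc q) (v j)) τ))
                (null n<L n<L′ (ι i′) (ρ i) q n<m₀ acyclic α β e {v j} (v-cycle j))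

            block : ∀ τ → lincomb K c (λ x → target (x ₁) (x ₂)) τ ≡ lincomb a (λ j → c (Fin.combine i j)) v τ
            block τ = begin
              ΣF K (λ x → c x * target (x ₁) (x ₂) τ)
                ≡⟨ ΣF-combine l a (λ x → c x * target (x ₁) (x ₂) τ) ⟩
              ΣF l (λ i′ → ΣF a (λ j → c (Fin.combine i′ j) * target (Fin.combine i′ j ₁) (Fin.combine i′ j ₂) τ))
                ≡⟨ ΣF-cong l (λ i′ → ΣF-cong a (λ j → cong (λ p → c (Fin.combine i′ j) * target (proj₁ p) (proj₂ p) τ) (Finₚ.remQuot-combine i′ j))) ⟩
              ΣF l (λ i′ → ΣF a (λ j → c (Fin.combine i′ j) * target i′ j τ))
                ≡⟨ ΣF-single i (λ i′ i≢i′ → ΣF-zero a (λ j → trans (cong (c (Fin.combine i′ j) *_) (target-other i≢i′ j)) (ℚₚ.*-zeroʳ (c (Fin.combine i′ j))))) ⟩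
              ΣF a (λ j → c (Fin.combine i j) * target i j τ)
                ≡⟨ ΣF-cong a (λ j → cong (c (Fin.combine i j) *_) (target-self j)) ⟩
              ΣF a (λ j → c (Fin.combine i j) * v j τ) ∎
              where
              target-other : ∀ {i′} → i ≢ i′ → ∀ j → target i′ j τ ≡ 0ℚ
              target-other {i′} i≢i′ j with i Finₚ.≟ i′
              ... | yes e = contradiction e i≢i′
              ... | no _  = refl
              target-self : ∀ j → target i j τ ≡ v j τ
              target-self j with i Finₚ.≟ i
              ... | yes _ = refl
              ... | no ≢  = contradiction refl ≢

            -- ρᵢ sends the boundary from `U-boundary` to a boundary; replacing each ρᵢ (`u x`) by
            -- its `target` leaves block `i` of the relation.
            block-boundary : Boundary L q (lincomb a (λ j → c (Fin.combine i j)) v)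
            block-boundary = boundary-cong L q {y = λ τ → ρ⁎ (lincomb K c u) τ - lincomb K c D τ} split (boundary-sub L q {ρ⁎ (lincomb K c u)} {lincomb K c D}
              (⁎-boundary (induced n<L (ρ i)) q {lincomb K c u} U-boundary)
              (boundary-lincomb L q K c {D} (λ x → ρu-target (x ₁) (x ₂))))
              where
              D : Fin K → C L (suc q)
              D x τ = ρ⁎ (u x) τ - target (x ₁) (x ₂) τ

              split : ∀ τ → lincomb a (λ j → c (Fin.combine i j)) v τ ≡
                            ρ⁎ (lincomb K c u) τ - lincomb K c D τ
              split τ = begin
                lincomb a (λ j → c (Fin.combine i j)) v τ
                  ≡⟨ sym (block τ) ⟩
                ΣF K (λ x → c x * target (x ₁) (x ₂) τ)
                  ≡⟨ ΣF-cong K (λ x → solve 3 (λ a b c → a :* c := a :* b :- a :* (b :- c)) refl (c x) (ρ⁎ (u x) τ) (target (x ₁) (x ₂) τ)) ⟩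
                ΣF K (λ x → c x * ρ⁎ (u x) τ - c x * (ρ⁎ (u x) τ - target (x ₁) (x ₂) τ))
                  ≡⟨ ΣF-sub K (λ x → c x * ρ⁎ (u x) τ) (λ x → c x * (ρ⁎ (u x) τ - target (x ₁) (x ₂) τ)) ⟩
                ΣF K (λ x → c x * ρ⁎ (u x) τ) - ΣF K (λ x → c x * (ρ⁎ (u x) τ - target (x ₁) (x ₂) τ))
                  ≡⟨ cong (_- ΣF K (λ x → c x * (ρ⁎ (u x) τ - target (x ₁) (x ₂) τ)))
                       (sym (eval-lincomb L′ (suc q) K c u (λ t → at (induced n<L (ρ i)) t (indicator L (suc q) τ)))) ⟩
                ρ⁎ (lincomb K c u) τ - ΣF K (λ x → c x * (ρ⁎ (u x) τ - target (x ₁) (x ₂) τ)) ∎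

          c≡0 : ∀ x → c x ≡ 0ℚ
          c≡0 x = subst (λ x → c x ≡ 0ℚ) (Finₚ.combine-remQuot {l} a x)
            (v-independent (λ j → c (Fin.combine (x ₁) j)) (block-boundary (x ₁)) (x ₂))

        too-few : ⊥
        too-few = c≢0 (c≡0 i₀)

      rank-bound : ∀ a b → KRank (suc n) L q a → KRank (suc n) L′ q b → l ℕ.* a ℕ.≤ b
      rank-bound a b (v , v-cycle , v-independent , _) (w , _ , _ , w-spans) =
        ℕₚ.≮⇒≥ (too-few v v-cycle v-independent w w-spans)

  -- `punchOut` removes the missed value and `punchIn` puts it back, which routes the composite
  -- through one element fewer.
  collapse-skip-factors : ∀ {k} (i j : Fin (suc k)) → i ≢ j →
    ∃ λ (α : Fin (suc k) → Fin k) → ∃ λ (β : Fin k → Fin (suc k)) → ∀ x → β (α x) ≡ collapse i (skip j x)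
  collapse-skip-factors i j i≢j =
    (λ x → punchOut (misses x)) , punchIn (collapse i (suc j)) , λ x → Finₚ.punchIn-punchOut (misses x)
    where misses = collapse-skip-misses i j i≢j

open IntersectingFamilies

open import Data.Nat using (ℕ; suc; _*_; _≤_; _<_)

theorem5p1 : (n q ℓ : ℕ) → 1 ≤ n → 1 ≤ q → n ≤ ℓ
    → ¬ KRank n ℓ q 0
    → (∀ ℓ′ → n ≤ ℓ′ → ℓ′ < ℓ → KRank n ℓ′ q 0)
    → ∀ a b → KRank n ℓ q a → KRank n (suc ℓ) q b → ℓ * a ≤ b
theorem5p1 (suc n) q (suc ℓ) _ _ n<1+ℓ nontrivial minimal = case suc n ℕₚ.≟ suc ℓ of λ where
  (yes n≡ℓ) → ⊥-elim (nontrivial (Intersecting.full-acyclic n {suc ℓ} (sym n≡ℓ) q))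
  -- The sets still fit into a ground set with one element fewer, where minimality gives the
  -- vanishing that `rank-bound` asks of `m₀`.
  (no n≢ℓ)  → let n<ℓ = ℕₚ.≤-pred (ℕₚ.≤∧≢⇒< n<1+ℓ n≢ℓ) in
    Intersecting.rank-bound n {ℓ} {suc ℓ} {2 ℕ.+ ℓ} n<ℓ n<1+ℓ (ℕₚ.m≤n⇒m≤1+n n<1+ℓ)
      {suc ℓ} skip collapse collapse-skip collapse-skip-factors q (minimal ℓ n<ℓ (ℕₚ.n<1+n ℓ))
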